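{- There exist a constant $c>0$ and an infinite sequence $M_1,M_2,\ldots$ of partial $0$-$1$ matrices with $\operatorname{rank}_+(M_t)\to\infty$ as $t\to\infty$ such that for every $t$, $$\operatorname{rank}_{0,1}(M_t)\ \ge\ 2^{\operatorname{rank}_+(M_t)^{c}}.$$
   Context: A partial $0$-$1$ matrix is a finite matrix with entries in $\{0,1,*\}$, where $*$ entries are wildcards. For a total $n\times m$ real matrix $N$ with nonnegative entries, the nonnegative rank $\operatorname{rank}_+(N)$ is the smallest $r$ such that $N=UV$ with $U$ an $n\times r$ and $V$ an $r\times m$ real matrix, both entrywise nonnegative. For a total $n\times m$ matrix $N$ with nonnegative integer entries, the binary rank $\operatorname{rank}_{0,1}(N)$ is the smallest $r$ such that $N=UV$ (ordinary arithmetic over the reals) with $U$ an $n\times r$ and $V$ an $r\times m$ matrix, both with all entries in $\{0,1\}$. For a partial $0$-$1$ matrix $M$, $\operatorname{rank}_+(M)$ is the minimum of $\operatorname{rank}_+(N)$ over all total real matrices $N$ with nonnegative entries that agree with $M$ on all non-$*$ entries of $M$; and $\operatorname{rank}_{0,1}(M)$ is the minimum of $\operatorname{rank}_{0,1}(N)$ over all total matrices $N$ with nonnegative integer entries that agree with $M$ on all non-$*$ entries of $M$. In both cases the entries of $N$ at the $*$ positions need not lie in $\{0,1\}$. -}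

module Defs where

open import Data.Fin.Base using (Fin)
open import Data.Integer.Base using (+_)
open import Data.Nat.Base as ℕ using (ℕ; zero; suc)
import Data.Nat.Properties as ℕₚ
open import Data.Product.Base using (Σ; ∃-syntax; _×_; _,_; proj₁; proj₂)
open import Data.Rational.Base as ℚ using (ℚ; 0ℚ; 1ℚ; ½)
import Data.Rational.Properties as ℚₚ
open import Data.Rational.Solver using (module +-*-Solver)
open import Data.Sum.Base using (_⊎_)
open import Data.Unit.Base using (⊤)
open import Data.Vec.Functional using (foldr)
open import Relation.Binary.PropositionalEquality using (_≡_; refl; sym; trans; cong; cong₂)

------------------------------------------------------------------------
-- Real numbers, as Cauchy sequences of rationals with a modulus of
-- convergence.  Equality of reals is the setoid equality _≃_.

IsCauchy : (ℕ → ℚ) → Set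
IsCauchy x = ∀ ε → 0ℚ ℚ.< ε →
  ∃[ N ] (∀ m n → N ℕ.≤ m → N ℕ.≤ n → ℚ.∣ x m ℚ.- x n ∣ ℚ.≤ ε)

record ℝ : Set where
  constructor mkℝ
  field
    seq    : ℕ → ℚ
    cauchy : IsCauchy seq

open ℝ public

infix 4 _≃_ _≤ᴿ_ _<ᴿ_

_≃_ : ℝ → ℝ → Set
x ≃ y = ∀ ε → 0ℚ ℚ.< ε →
  ∃[ N ] (∀ n → N ℕ.≤ n → ℚ.∣ seq x n ℚ.- seq y n ∣ ℚ.≤ ε)

_≤ᴿ_ : ℝ → ℝ → Set
x ≤ᴿ y = ∀ ε → 0ℚ ℚ.< ε →
  ∃[ N ] (∀ n → N ℕ.≤ n → seq x n ℚ.≤ seq y n ℚ.+ ε)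

_<ᴿ_ : ℝ → ℝ → Set
x <ᴿ y = ∃[ ε ] (0ℚ ℚ.< ε ×
  ∃[ N ] (∀ n → N ℕ.≤ n → seq x n ℚ.+ ε ℚ.≤ seq y n))

fromℚ : ℚ → ℝ
fromℚ q = mkℝ (λ _ → q) λ ε 0<ε → 0 , λ _ _ _ _ →
  ℚₚ.≤-trans (ℚₚ.≤-reflexive (cong ℚ.∣_∣ (ℚₚ.+-inverseʳ q))) (ℚₚ.<⇒≤ 0<ε)

fromℕ : ℕ → ℝ
fromℕ n = fromℚ (+ n ℚ./ 1)

0ℝ 1ℝ : ℝ
0ℝ = fromℚ 0ℚ
1ℝ = fromℚ 1ℚ

open +-*-Solver using (solve; _:=_; _:+_; _:*_; _:-_)

private abstract
  0<* : ∀ {p q} → 0ℚ ℚ.< p → 0ℚ ℚ.< q → 0ℚ ℚ.< p ℚ.* q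
  0<* {p} {q} 0<p 0<q =
    ℚₚ.positive⁻¹ (p ℚ.* q)
      {{ℚₚ.pos*pos⇒pos p {{ℚ.positive 0<p}} q {{ℚ.positive 0<q}}}}

  *-mono-≤ : ∀ {a b c d} → 0ℚ ℚ.≤ c → 0ℚ ℚ.≤ b →
             a ℚ.≤ b → c ℚ.≤ d → a ℚ.* c ℚ.≤ b ℚ.* d
  *-mono-≤ {a} {b} {c} {d} 0≤c 0≤b a≤b c≤d = ℚₚ.≤-trans
    (ℚₚ.*-monoʳ-≤-nonNeg c {{ℚ.nonNegative 0≤c}} a≤b)
    (ℚₚ.*-monoˡ-≤-nonNeg b {{ℚ.nonNegative 0≤b}} c≤d)

  0≤∣_∣ : ∀ p → 0ℚ ℚ.≤ ℚ.∣ p ∣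
  0≤∣ p ∣ = ℚₚ.0≤∣p∣ p

  halves : ∀ ε → ε ℚ.* ½ ℚ.+ ε ℚ.* ½ ≡ ε
  halves ε = trans (sym (ℚₚ.*-distribˡ-+ ε ½ ½)) (ℚₚ.*-identityʳ ε)

  +-cauchy : ∀ x y → IsCauchy x → IsCauchy y → IsCauchy (λ n → x n ℚ.+ y n)
  +-cauchy x y cx cy ε 0<ε =
    let δ = ε ℚ.* ½
        0<δ = 0<* 0<ε (ℚₚ.positive⁻¹ ½)
        (N₁ , h₁) = cx δ 0<δ
        (N₂ , h₂) = cy δ 0<δ
    in N₁ ℕ.⊔ N₂ , λ m n N≤m N≤n → begin
      ℚ.∣ (x m ℚ.+ y m) ℚ.- (x n ℚ.+ y n) ∣
        ≡⟨ cong ℚ.∣_∣ (regroup (x m) (y m) (x n) (y n)) ⟩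
      ℚ.∣ (x m ℚ.- x n) ℚ.+ (y m ℚ.- y n) ∣
        ≤⟨ ℚₚ.∣p+q∣≤∣p∣+∣q∣ (x m ℚ.- x n) (y m ℚ.- y n) ⟩
      ℚ.∣ x m ℚ.- x n ∣ ℚ.+ ℚ.∣ y m ℚ.- y n ∣
        ≤⟨ ℚₚ.+-mono-≤
             (h₁ m n (ℕₚ.m⊔n≤o⇒m≤o N₁ N₂ N≤m) (ℕₚ.m⊔n≤o⇒m≤o N₁ N₂ N≤n))
             (h₂ m n (ℕₚ.m⊔n≤o⇒n≤o N₁ N₂ N≤m) (ℕₚ.m⊔n≤o⇒n≤o N₁ N₂ N≤n)) ⟩
      δ ℚ.+ δ
        ≡⟨ halves ε ⟩
      ε ∎
    where
    open ℚₚ.≤-Reasoning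
    regroup : ∀ a b c d → (a ℚ.+ b) ℚ.- (c ℚ.+ d) ≡ (a ℚ.- c) ℚ.+ (b ℚ.- d)
    regroup = solve 4 (λ a b c d →
      (a :+ b) :- (c :+ d) := (a :- c) :+ (b :- d)) refl

  eventuallyBounded : ∀ x → IsCauchy x →
    ∃[ A ] (0ℚ ℚ.< A × ∃[ N ] (∀ n → N ℕ.≤ n → ℚ.∣ x n ∣ ℚ.≤ A))
  eventuallyBounded x cx =
    let (N , h) = cx 1ℚ (ℚₚ.positive⁻¹ 1ℚ) in
    1ℚ ℚ.+ ℚ.∣ x N ∣ ,
    ℚₚ.+-mono-<-≤ (ℚₚ.positive⁻¹ 1ℚ) 0≤∣ x N ∣ ,
    N , λ n N≤n → begin
      ℚ.∣ x n ∣
        ≡⟨ cong ℚ.∣_∣ (shift (x n) (x N)) ⟩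
      ℚ.∣ (x n ℚ.- x N) ℚ.+ x N ∣
        ≤⟨ ℚₚ.∣p+q∣≤∣p∣+∣q∣ (x n ℚ.- x N) (x N) ⟩
      ℚ.∣ x n ℚ.- x N ∣ ℚ.+ ℚ.∣ x N ∣
        ≤⟨ ℚₚ.+-monoˡ-≤ ℚ.∣ x N ∣ (h n N N≤n ℕₚ.≤-refl) ⟩
      1ℚ ℚ.+ ℚ.∣ x N ∣ ∎
    where
    open ℚₚ.≤-Reasoning
    shift : ∀ a b → a ≡ (a ℚ.- b) ℚ.+ b
    shift = solve 2 (λ a b → a := (a :- b) :+ b) refl

  *-cauchy-bounded : ∀ x y A B K₁ K₂ → 0ℚ ℚ.< A → 0ℚ ℚ.< B →
    (∀ n → K₁ ℕ.≤ n → ℚ.∣ x n ∣ ℚ.≤ A) → (∀ n → K₂ ℕ.≤ n → ℚ.∣ y n ∣ ℚ.≤ B) →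
    IsCauchy x → IsCauchy y → IsCauchy (λ n → x n ℚ.* y n)
  *-cauchy-bounded x y A B K₁ K₂ 0<A 0<B b₁ b₂ cx cy ε 0<ε = N , bound
    where
    open ℚₚ.≤-Reasoning
    C : ℚ
    C = A ℚ.+ B
    instance
      C-pos : ℚ.Positive C
      C-pos = ℚ.positive (ℚₚ.+-mono-< 0<A 0<B)
      C-nonZero : ℚ.NonZero C
      C-nonZero = ℚₚ.pos⇒nonZero C
    δ : ℚ
    δ = ℚ.1/ C ℚ.* ε
    0<δ : 0ℚ ℚ.< δ
    0<δ = 0<* (ℚₚ.positive⁻¹ (ℚ.1/ C) {{ℚₚ.1/pos⇒pos C}}) 0<ε
    N₁ N₂ N : ℕ
    N₁ = proj₁ (cx δ 0<δ)
    N₂ = proj₁ (cy δ 0<δ)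
    N  = (K₁ ℕ.⊔ K₂) ℕ.⊔ (N₁ ℕ.⊔ N₂)
    K₁≤ : ∀ {n} → N ℕ.≤ n → K₁ ℕ.≤ n
    K₁≤ h = ℕₚ.m⊔n≤o⇒m≤o K₁ K₂ (ℕₚ.m⊔n≤o⇒m≤o (K₁ ℕ.⊔ K₂) (N₁ ℕ.⊔ N₂) h)
    K₂≤ : ∀ {n} → N ℕ.≤ n → K₂ ℕ.≤ n
    K₂≤ h = ℕₚ.m⊔n≤o⇒n≤o K₁ K₂ (ℕₚ.m⊔n≤o⇒m≤o (K₁ ℕ.⊔ K₂) (N₁ ℕ.⊔ N₂) h)
    N₁≤ : ∀ {n} → N ℕ.≤ n → N₁ ℕ.≤ n
    N₁≤ h = ℕₚ.m⊔n≤o⇒m≤o N₁ N₂ (ℕₚ.m⊔n≤o⇒n≤o (K₁ ℕ.⊔ K₂) (N₁ ℕ.⊔ N₂) h)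
    N₂≤ : ∀ {n} → N ℕ.≤ n → N₂ ℕ.≤ n
    N₂≤ h = ℕₚ.m⊔n≤o⇒n≤o N₁ N₂ (ℕₚ.m⊔n≤o⇒n≤o (K₁ ℕ.⊔ K₂) (N₁ ℕ.⊔ N₂) h)
    regroup : ∀ a b c d →
      a ℚ.* b ℚ.- c ℚ.* d ≡ a ℚ.* (b ℚ.- d) ℚ.+ d ℚ.* (a ℚ.- c)
    regroup = solve 4 (λ a b c d →
      a :* b :- c :* d := a :* (b :- d) :+ d :* (a :- c)) refl
    bound : ∀ m n → N ℕ.≤ m → N ℕ.≤ n →
            ℚ.∣ x m ℚ.* y m ℚ.- x n ℚ.* y n ∣ ℚ.≤ ε
    bound m n N≤m N≤n = begin
      ℚ.∣ x m ℚ.* y m ℚ.- x n ℚ.* y n ∣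
        ≡⟨ cong ℚ.∣_∣ (regroup (x m) (y m) (x n) (y n)) ⟩
      ℚ.∣ x m ℚ.* (y m ℚ.- y n) ℚ.+ y n ℚ.* (x m ℚ.- x n) ∣
        ≤⟨ ℚₚ.∣p+q∣≤∣p∣+∣q∣ (x m ℚ.* (y m ℚ.- y n)) (y n ℚ.* (x m ℚ.- x n)) ⟩
      ℚ.∣ x m ℚ.* (y m ℚ.- y n) ∣ ℚ.+ ℚ.∣ y n ℚ.* (x m ℚ.- x n) ∣
        ≡⟨ cong₂ ℚ._+_ (ℚₚ.∣p*q∣≡∣p∣*∣q∣ (x m) (y m ℚ.- y n))
                       (ℚₚ.∣p*q∣≡∣p∣*∣q∣ (y n) (x m ℚ.- x n)) ⟩
      ℚ.∣ x m ∣ ℚ.* ℚ.∣ y m ℚ.- y n ∣ ℚ.+ ℚ.∣ y n ∣ ℚ.* ℚ.∣ x m ℚ.- x n ∣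
        ≤⟨ ℚₚ.+-mono-≤
             (*-mono-≤ 0≤∣ y m ℚ.- y n ∣ (ℚₚ.<⇒≤ 0<A) (b₁ m (K₁≤ N≤m))
               (proj₂ (cy δ 0<δ) m n (N₂≤ N≤m) (N₂≤ N≤n)))
             (*-mono-≤ 0≤∣ x m ℚ.- x n ∣ (ℚₚ.<⇒≤ 0<B) (b₂ n (K₂≤ N≤n))
               (proj₂ (cx δ 0<δ) m n (N₁≤ N≤m) (N₁≤ N≤n))) ⟩
      A ℚ.* δ ℚ.+ B ℚ.* δ
        ≡⟨ sym (ℚₚ.*-distribʳ-+ δ A B) ⟩
      C ℚ.* δ
        ≡⟨ sym (ℚₚ.*-assoc C (ℚ.1/ C) ε) ⟩
      (C ℚ.* ℚ.1/ C) ℚ.* ε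
        ≡⟨ cong (ℚ._* ε) (ℚₚ.*-inverseʳ C) ⟩
      1ℚ ℚ.* ε
        ≡⟨ ℚₚ.*-identityˡ ε ⟩
      ε ∎

  *-cauchy : ∀ x y → IsCauchy x → IsCauchy y → IsCauchy (λ n → x n ℚ.* y n)
  *-cauchy x y cx cy =
    let (A , 0<A , K₁ , b₁) = eventuallyBounded x cx
        (B , 0<B , K₂ , b₂) = eventuallyBounded y cy
    in *-cauchy-bounded x y A B K₁ K₂ 0<A 0<B b₁ b₂ cx cy

infixl 6 _+ᴿ_
infixl 7 _*ᴿ_
infixr 8 _^ᴿ_

_+ᴿ_ : ℝ → ℝ → ℝ
x +ᴿ y = mkℝ (λ n → seq x n ℚ.+ seq y n)
             (+-cauchy (seq x) (seq y) (cauchy x) (cauchy y))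

_*ᴿ_ : ℝ → ℝ → ℝ
x *ᴿ y = mkℝ (λ n → seq x n ℚ.* seq y n)
             (*-cauchy (seq x) (seq y) (cauchy x) (cauchy y))

_^ᴿ_ : ℝ → ℕ → ℝ
x ^ᴿ zero  = 1ℝ
x ^ᴿ suc n = x *ᴿ (x ^ᴿ n)

-- IsPow b x y says that y is the real power b ^ x, for a natural base b and
-- a real exponent x, where x > 0 if b = 0 and x ≥ 0 otherwise.  For b ≥ 1 it
-- is the monotone extension of rational powers: b ^ (p / q) ≤ y whenever
-- p / q ≤ x, and y ≤ b ^ (p / q) whenever x ≤ p / q, with q-th roots cleared.
-- This determines y up to _≃_.
IsPow : ℕ → ℝ → ℝ → Set
IsPow zero      x y = y ≃ 0ℝ
IsPow b@(suc _) x y = 0ℝ ≤ᴿ y ×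
  (∀ p q .{{_ : ℕ.NonZero q}} →
    (fromℚ (+ p ℚ./ q) ≤ᴿ x → fromℕ (b ℕ.^ p) ≤ᴿ y ^ᴿ q) ×
    (x ≤ᴿ fromℚ (+ p ℚ./ q) → y ^ᴿ q ≤ᴿ fromℕ (b ℕ.^ p)))

------------------------------------------------------------------------
-- Matrices

Matrix : Set → ℕ → ℕ → Set
Matrix A n m = Fin n → Fin m → A

mulℝ : ∀ {n r m} → Matrix ℝ n r → Matrix ℝ r m → Matrix ℝ n m
mulℝ U V i j = foldr _+ᴿ_ 0ℝ (λ k → U i k *ᴿ V k j)

mulℕ : ∀ {n r m} → Matrix ℕ n r → Matrix ℕ r m → Matrix ℕ n m
mulℕ U V i j = foldr ℕ._+_ 0 (λ k → U i k ℕ.* V k j)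

Nonnegative : ∀ {n m} → Matrix ℝ n m → Set
Nonnegative A = ∀ i j → 0ℝ ≤ᴿ A i j

Binary : ∀ {n m} → Matrix ℕ n m → Set
Binary A = ∀ i j → A i j ≡ 0 ⊎ A i j ≡ 1

data Entry : Set where
  𝟎 𝟏 ⋆ : Entry

record PartialMatrix : Set where
  constructor mkPartial
  field
    rows cols : ℕ
    entry     : Matrix Entry rows cols

open PartialMatrix public

Agreesℝ : Entry → ℝ → Set
Agreesℝ 𝟎 x = x ≃ 0ℝ
Agreesℝ 𝟏 x = x ≃ 1ℝ
Agreesℝ ⋆ x = ⊤

Agreesℕ : Entry → ℕ → Set
Agreesℕ 𝟎 x = x ≡ 0
Agreesℕ 𝟏 x = x ≡ 1
Agreesℕ ⋆ x = ⊤

------------------------------------------------------------------------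
-- Ranks.  Each rank is a minimum, given as the relation "r is the rank".

IsMinimum : (ℕ → Set) → ℕ → Set
IsMinimum P r = P r × (∀ s → P s → r ℕ.≤ s)

IsRank₊-total : ∀ {n m} → Matrix ℝ n m → ℕ → Set
IsRank₊-total {n} {m} N = IsMinimum λ r →
  Σ (Matrix ℝ n r) λ U → Σ (Matrix ℝ r m) λ V →
    Nonnegative U × Nonnegative V × (∀ i j → N i j ≃ mulℝ U V i j)

IsRank₀₁-total : ∀ {n m} → Matrix ℕ n m → ℕ → Set
IsRank₀₁-total {n} {m} N = IsMinimum λ r →
  Σ (Matrix ℕ n r) λ U → Σ (Matrix ℕ r m) λ V →
    Binary U × Binary V × (∀ i j → N i j ≡ mulℕ U V i j)

IsRank₊ : PartialMatrix → ℕ → Set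
IsRank₊ M = IsMinimum λ r →
  Σ (Matrix ℝ (rows M) (cols M)) λ N →
    Nonnegative N × (∀ i j → Agreesℝ (entry M i j) (N i j)) × IsRank₊-total N r

IsRank₀₁ : PartialMatrix → ℕ → Set
IsRank₀₁ M = IsMinimum λ r →
  Σ (Matrix ℕ (rows M) (cols M)) λ N →
    (∀ i j → Agreesℕ (entry M i j) (N i j)) × IsRank₀₁-total N r

TendsToInfinity : (ℕ → ℕ) → Set
TendsToInfinity f = ∀ K → ∃[ T ] (∀ t → T ℕ.≤ t → K ℕ.≤ f t)

{-# OPTIONS --safe #-}
module Submission where

-- Index rows and columns by words of length 2k over an alphabet with 2k letters
-- and a blank, where k = 2^e, and let s be the number of positions at which a
-- row and a column carry the same letter.  The entry is 0 if s = 0, 1 if s = k,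
-- and a wildcard otherwise.  Scaling by 1/k, the integer s has a nonnegative
-- factorization of size (2k)², and an extra identity block makes this exact.
--
-- For the binary rank, reduce a factorization of size r modulo 2.  For s < 2k,
-- the number of subsets of size < k of an s-set is odd exactly for s ∈ {0, k}.
-- As a polynomial in the position-wise agreements it has degree < k, hence low
-- rank, and it vanishes on the wildcards.  Its product with any completion N is
-- therefore the indicator of s = k.  Summing the columns over all ways to blank
-- out letters of a fixed word b of length 2k − 1 turns this indicator into the
-- identity matrix of size (2k)^(2k−1), because C(2k − 1, k) is odd and unequal
-- letters cancel in pairs.  Comparing ranks over 𝔽₂ gives r ≥ 2^(2k).

open import Defs
open import Data.Bool.Base using (Bool; true; false; _∧_; _xor_; not; if_then_else_)
import Data.Bool.Properties as 𝔹
open import Data.Empty using (⊥; ⊥-elim)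
open import Data.Fin.Base as Fin using (Fin; zero; suc)
import Data.Fin.Properties as Finₚ
import Data.Integer.Base as ℤ
import Data.Integer.Properties as ℤₚ
open import Data.List.Base as List using (List; []; _∷_; _++_; length)
import Data.List.Properties as Listₚ
open import Data.Nat.Base as ℕ using (ℕ; zero; suc; _+_; _*_; _^_; _≤_; _<_; z≤n; s≤s; _≡ᵇ_)
import Data.Nat.Properties as ℕₚ
import Data.Nat.Solver as ℕ-Solver
open import Data.Product.Base using (Σ; ∃-syntax; _×_; _,_; proj₁; proj₂)
open import Data.Rational.Base as ℚ using (ℚ; 0ℚ; 1ℚ; ½)
import Data.Rational.Properties as ℚₚ
import Data.Rational.Solver as ℚ-Solver
open import Data.Rational.Unnormalised.Base as ℚᵘ using (mkℚᵘ; *≡*; *≤*)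
import Data.Rational.Unnormalised.Properties as ℚᵘₚ
open import Data.Sum.Base as Sum using (_⊎_; inj₁; inj₂; [_,_]′)
open import Data.Vec.Base as Vec using (Vec; []; _∷_)
import Data.Vec.Functional as VF
import Data.Vec.Properties as Vecₚ
open import Function.Base using (_∘_)
open import Function.Bundles using (Inverse)
open import Relation.Binary.Definitions using (tri<; tri≈; tri>)
open import Relation.Binary.PropositionalEquality using (_≡_; _≢_; _≗_; refl; sym; trans; cong; cong₂; subst; subst₂; module ≡-Reasoning)
open import Relation.Nullary.Decidable using (Dec; yes; no; does; dec-true; dec-false; map′)
open import Relation.Nullary.Negation using (contradiction)

-- Binomial coefficients modulo 2

binom₂ : ℕ → ℕ → Bool
binom₂ zero    zero    = true
binom₂ zero    (suc j) = false
binom₂ (suc s) zero    = true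
binom₂ (suc s) (suc j) = binom₂ s (suc j) xor binom₂ s j

binom₂-zero : ∀ s → binom₂ s 0 ≡ true
binom₂-zero zero    = refl
binom₂-zero (suc s) = refl

binom₂-< : ∀ {s j} → s < j → binom₂ s j ≡ false
binom₂-< {zero}  {suc j} _         = refl
binom₂-< {suc s} {suc j} (s≤s s<j) =
  cong₂ _xor_ (binom₂-< (ℕₚ.m<n⇒m<1+n s<j)) (binom₂-< s<j)

binom₂-diag : ∀ s → binom₂ s s ≡ true
binom₂-diag zero    = refl
binom₂-diag (suc s) = cong₂ _xor_ (binom₂-< (ℕₚ.n<1+n s)) (binom₂-diag s)

-- (1 + X)^d = 1 + X^d over 𝔽₂, read off coefficientwise in (1 + X)^(s + d).
record Frobenius (d : ℕ) : Set where
  field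
    low  : ∀ s j → j < d → binom₂ (d + s) j ≡ binom₂ s j
    high : ∀ s j → binom₂ (d + s) (d + j) ≡ binom₂ s (d + j) xor binom₂ s j

open Frobenius

xor-cancel-middle : ∀ x y z → (x xor y) xor (y xor z) ≡ x xor z
xor-cancel-middle x y z = begin
  (x xor y) xor (y xor z) ≡⟨ 𝔹.xor-assoc x y (y xor z) ⟩
  x xor (y xor (y xor z)) ≡⟨ cong (x xor_) (𝔹.xor-assoc y y z) ⟨
  x xor ((y xor y) xor z) ≡⟨ cong (λ w → x xor (w xor z)) (𝔹.xor-same y) ⟩
  x xor z                 ∎
  where open ≡-Reasoning

-- Applying the rule for `d` twice squares 1 + X^d; the two copies of the middle term 2X^d cancel
-- modulo 2.
frobenius-double : ∀ {d} → Frobenius d → Frobenius (d + d)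
frobenius-double {d} F .high s j
  rewrite ℕₚ.+-assoc d d s | ℕₚ.+-assoc d d j
        | F .high (d + s) (d + j) | F .high s (d + j) | F .high s j =
  xor-cancel-middle (binom₂ s (d + (d + j))) (binom₂ s (d + j)) (binom₂ s j)
frobenius-double {d} F .low s j j<d+d with j ℕₚ.<? d
... | yes j<d rewrite ℕₚ.+-assoc d d s =
  trans (F .low (d + s) j j<d) (F .low s j j<d)
... | no j≮d with ℕₚ.m≤n⇒∃[o]m+o≡n (ℕₚ.≮⇒≥ j≮d)
... | i , refl rewrite ℕₚ.+-assoc d d s
                     | F .high (d + s) i | F .high s i
                     | F .low s i (ℕₚ.+-cancelˡ-< d i d j<d+d) = begin
  (x xor y) xor y             ≡⟨ 𝔹.xor-assoc x y y ⟩
  x xor (y xor y)             ≡⟨ cong (x xor_) (𝔹.xor-same y) ⟩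
  x xor false                 ≡⟨ 𝔹.xor-identityʳ x ⟩
  x                           ∎
  where
  open ≡-Reasoning
  x y : Bool
  x = binom₂ s (d + i)
  y = binom₂ s i

frobenius : ∀ e → Frobenius (2 ^ e)
frobenius zero    .low s zero    _ = sym (binom₂-zero s)
frobenius zero    .low s (suc j) (s≤s ())
frobenius zero    .high s j = refl
frobenius (suc e) = subst Frobenius (cong (2 ^ e +_) (sym (ℕₚ.+-identityʳ (2 ^ e))))
                      (frobenius-double (frobenius e))

-- Parity of the number of subsets of size < j of an s-element set.
subsets₂ : ℕ → ℕ → Bool
subsets₂ zero    s       = false
subsets₂ (suc j) zero    = true
subsets₂ (suc j) (suc s) = subsets₂ (suc j) s xor subsets₂ j s

-- By Pascal's rule the sum of C(s + 1, i) over i ≤ j telescopes modulo 2, and only C(s, j)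
-- survives.
subsets₂-suc : ∀ j s → subsets₂ (suc j) (suc s) ≡ binom₂ s j
subsets₂-suc zero    zero    = refl
subsets₂-suc (suc j) zero    = refl
subsets₂-suc zero    (suc s) =
  trans (𝔹.xor-identityʳ _) (trans (subsets₂-suc zero s) (binom₂-zero s))
subsets₂-suc (suc j) (suc s) = cong₂ _xor_ (subsets₂-suc (suc j) s) (subsets₂-suc j s)

-- With k = k′ + 1 the value at s ≥ 1 is C(s - 1, k - 1). It is 0 for s < k. For k < s < 2k write s
-- - 1 = k + i with i < k - 1; the Frobenius rule reduces it to C(i, k - 1) = 0.
subsets₂-vanishes : ∀ {k′} → Frobenius (suc k′) → ∀ s → s ≢ 0 → s ≢ suc k′ →
  s < suc k′ + suc k′ → subsets₂ (suc k′) s ≡ false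
subsets₂-vanishes F zero s≢0 _ _ = contradiction refl s≢0
subsets₂-vanishes {k′} F (suc s) _ s≢k s<2k rewrite subsets₂-suc k′ s with ℕₚ.<-cmp s k′
... | tri< s<k′ _ _ = binom₂-< s<k′
... | tri≈ _ s≡k′ _ = contradiction (cong suc s≡k′) s≢k
... | tri> _ _ k′<s with ℕₚ.m≤n⇒∃[o]m+o≡n k′<s
... | i , refl = trans (F .low i k′ (ℕₚ.n<1+n k′))
  (binom₂-< (ℕₚ.+-cancelˡ-< (suc k′) i k′
    (ℕₚ.≤-pred (subst (λ w → suc (suc k′ + i) < w) (ℕₚ.+-suc (suc k′) k′) s<2k))))

-- The Frobenius rule splits C(2k - 1, k) into C(k - 1, k) + C(k - 1, 0) = 0 + 1.
binom₂-odd : ∀ {k′} → Frobenius (suc k′) → binom₂ (suc k′ + k′) (suc k′) ≡ true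
binom₂-odd {k′} F = begin
  binom₂ (suc k′ + k′) (suc k′)
    ≡⟨ cong (binom₂ (suc k′ + k′)) (ℕₚ.+-identityʳ (suc k′)) ⟨
  binom₂ (suc k′ + k′) (suc k′ + 0)
    ≡⟨ F .high k′ 0 ⟩
  binom₂ k′ (suc k′ + 0) xor binom₂ k′ 0
    ≡⟨ cong₂ _xor_ (binom₂-< (s≤s (ℕₚ.m≤m+n k′ 0))) (binom₂-zero k′) ⟩
  true ∎
  where open ≡-Reasoning

-- Tensor rank over 𝔽₂

-- A matrix of rank at most q over 𝔽₂, given as a list of q rank-one terms.
Tensor : Set → Set → Set
Tensor X Y = List ((X → Bool) × (Y → Bool))

private variable
  X Y X′ Y′ : Set

⟦_⟧ : Tensor X Y → X → Y → Bool
⟦ []          ⟧ x y = false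
⟦ (f , g) ∷ L ⟧ x y = (f x ∧ g y) xor ⟦ L ⟧ x y

⟦⟧-++ : ∀ (K L : Tensor X Y) x y → ⟦ K ++ L ⟧ x y ≡ ⟦ K ⟧ x y xor ⟦ L ⟧ x y
⟦⟧-++ []            L x y = refl
⟦⟧-++ ((f , g) ∷ K) L x y =
  trans (cong ((f x ∧ g y) xor_) (⟦⟧-++ K L x y)) (sym (𝔹.xor-assoc (f x ∧ g y) _ _))

pull : (X′ → X) → (Y′ → Y) → Tensor X Y → Tensor X′ Y′
pull p q = List.map λ (f , g) → f ∘ p , g ∘ q

⟦⟧-pull : ∀ (p : X′ → X) (q : Y′ → Y) L x y → ⟦ pull p q L ⟧ x y ≡ ⟦ L ⟧ (p x) (q y)
⟦⟧-pull p q []            x y = refl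
⟦⟧-pull p q ((f , g) ∷ L) x y = cong ((f (p x) ∧ g (q y)) xor_) (⟦⟧-pull p q L x y)

scale : (X → Bool) × (Y → Bool) → Tensor X Y → Tensor X Y
scale (f , g) = List.map λ (f′ , g′) → (λ x → f x ∧ f′ x) , (λ y → g y ∧ g′ y)

∧-interchange : ∀ a b c d → (a ∧ c) ∧ (b ∧ d) ≡ (a ∧ b) ∧ (c ∧ d)
∧-interchange false b c d = refl
∧-interchange true  false c d = 𝔹.∧-zeroʳ c
∧-interchange true  true  c d = refl

⟦⟧-scale : ∀ (f : X → Bool) (g : Y → Bool) L x y →
  ⟦ scale (f , g) L ⟧ x y ≡ (f x ∧ g y) ∧ ⟦ L ⟧ x y
⟦⟧-scale f g []              x y = sym (𝔹.∧-zeroʳ _)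
⟦⟧-scale f g ((f′ , g′) ∷ L) x y = trans
  (cong₂ _xor_ (∧-interchange (f x) (g y) (f′ x) (g′ y)) (⟦⟧-scale f g L x y))
  (sym (𝔹.∧-distribˡ-xor (f x ∧ g y) _ _))

infixl 7 _⊙_

-- The entrywise (Hadamard) product: rank-one terms multiply pairwise, so rank bounds multiply.
_⊙_ : Tensor X Y → Tensor X Y → Tensor X Y
[]      ⊙ L = []
(t ∷ K) ⊙ L = scale t L ++ K ⊙ L

⟦⟧-⊙ : ∀ (K L : Tensor X Y) x y → ⟦ K ⊙ L ⟧ x y ≡ ⟦ K ⟧ x y ∧ ⟦ L ⟧ x y
⟦⟧-⊙ []            L x y = refl
⟦⟧-⊙ ((f , g) ∷ K) L x y = begin
  ⟦ scale (f , g) L ++ K ⊙ L ⟧ x y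
    ≡⟨ ⟦⟧-++ (scale (f , g) L) (K ⊙ L) x y ⟩
  ⟦ scale (f , g) L ⟧ x y xor ⟦ K ⊙ L ⟧ x y
    ≡⟨ cong₂ _xor_ (⟦⟧-scale f g L x y) (⟦⟧-⊙ K L x y) ⟩
  ((f x ∧ g y) ∧ ⟦ L ⟧ x y) xor (⟦ K ⟧ x y ∧ ⟦ L ⟧ x y)
    ≡⟨ 𝔹.∧-distribʳ-xor (⟦ L ⟧ x y) (f x ∧ g y) (⟦ K ⟧ x y) ⟨
  ((f x ∧ g y) xor ⟦ K ⟧ x y) ∧ ⟦ L ⟧ x y ∎
  where open ≡-Reasoning

length-⊙ : ∀ (K L : Tensor X Y) → length (K ⊙ L) ≡ length K * length L
length-⊙ []      L = refl
length-⊙ (t ∷ K) L = trans (Listₚ.length-++ (scale t L))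
  (cong₂ _+_ (Listₚ.length-map _ L) (length-⊙ K L))

dot : ∀ {n} → (Fin n → Bool) → (Fin n → Bool) → Bool
dot {zero}  g v = false
dot {suc n} g v = (g zero ∧ v zero) xor dot (g ∘ suc) (v ∘ suc)

dot-zeroˡ : ∀ {n} (v : Fin n → Bool) → dot (λ _ → false) v ≡ false
dot-zeroˡ {zero}  v = refl
dot-zeroˡ {suc n} v = dot-zeroˡ (v ∘ suc)

dot-congˡ : ∀ {n} {f g : Fin n → Bool} v → f ≗ g → dot f v ≡ dot g v
dot-congˡ {zero}  v f≗g = refl
dot-congˡ {suc n} v f≗g =
  cong₂ _xor_ (cong (_∧ v zero) (f≗g zero)) (dot-congˡ (v ∘ suc) (f≗g ∘ suc))

xor-interchange : ∀ a b c d → (a xor b) xor (c xor d) ≡ (a xor c) xor (b xor d)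
xor-interchange a b c d = begin
  (a xor b) xor (c xor d) ≡⟨ 𝔹.xor-assoc a b (c xor d) ⟩
  a xor (b xor (c xor d)) ≡⟨ cong (a xor_) (𝔹.xor-assoc b c d) ⟨
  a xor ((b xor c) xor d) ≡⟨ cong (λ w → a xor (w xor d)) (𝔹.xor-comm b c) ⟩
  a xor ((c xor b) xor d) ≡⟨ cong (a xor_) (𝔹.xor-assoc c b d) ⟩
  a xor (c xor (b xor d)) ≡⟨ 𝔹.xor-assoc a c (b xor d) ⟨
  (a xor c) xor (b xor d) ∎
  where open ≡-Reasoning

dot-linearˡ : ∀ {n} c (f g v : Fin n → Bool) →
  dot (λ i → (c ∧ f i) xor g i) v ≡ (c ∧ dot f v) xor dot g v
dot-linearˡ {zero}  c f g v = sym (trans (𝔹.xor-identityʳ _) (𝔹.∧-zeroʳ c))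
dot-linearˡ {suc n} c f g v = begin
  (((c ∧ f zero) xor g zero) ∧ v zero) xor dot (λ i → (c ∧ f (suc i)) xor g (suc i)) (v ∘ suc)
    ≡⟨ cong₂ _xor_
         (trans (𝔹.∧-distribʳ-xor (v zero) (c ∧ f zero) (g zero))
                (cong (_xor (g zero ∧ v zero)) (𝔹.∧-assoc c (f zero) (v zero))))
         (dot-linearˡ c (f ∘ suc) (g ∘ suc) (v ∘ suc)) ⟩
  ((c ∧ (f zero ∧ v zero)) xor (g zero ∧ v zero)) xor ((c ∧ dot (f ∘ suc) (v ∘ suc)) xor dot (g ∘ suc) (v ∘ suc))
    ≡⟨ xor-interchange (c ∧ (f zero ∧ v zero)) (g zero ∧ v zero) _ _ ⟩
  ((c ∧ (f zero ∧ v zero)) xor (c ∧ dot (f ∘ suc) (v ∘ suc))) xor dot g v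
    ≡⟨ cong (_xor dot g v) (𝔹.∧-distribˡ-xor c (f zero ∧ v zero) (dot (f ∘ suc) (v ∘ suc))) ⟨
  (c ∧ dot f v) xor dot g v ∎
  where open ≡-Reasoning

dot-δ : ∀ {n} (g v : Fin n → Bool) a → g a ≡ true → (∀ b → a ≢ b → g b ≡ false) → dot g v ≡ v a
dot-δ {suc n} g v zero    ga off rewrite ga = trans
  (cong (v zero xor_) (trans (dot-congˡ (v ∘ suc) (λ b → off (suc b) λ ()))
    (dot-zeroˡ (v ∘ suc))))
  (𝔹.xor-identityʳ (v zero))
dot-δ {suc n} g v (suc a) ga off rewrite off zero (λ ()) =
  dot-δ (g ∘ suc) (v ∘ suc) a ga (λ b a≢b → off (suc b) (a≢b ∘ Finₚ.suc-injective))

-- Words over a finite alphabet, numbered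

encode : ∀ {c n} → Vec (Fin c) n → Fin (c ^ n)
encode w = Fin.funToFin (Vec.lookup w)

decode : ∀ {c n} → Fin (c ^ n) → Vec (Fin c) n
decode {c} {n} i = Vec.tabulate (Fin.finToFun {c} {n} i)

decode-encode : ∀ {c n} (w : Vec (Fin c) n) → decode (encode w) ≡ w
decode-encode w =
  trans (Vecₚ.tabulate-cong (Finₚ.finToFun-funToFin (Vec.lookup w))) (Vecₚ.tabulate∘lookup w)

funToFin-cong : ∀ {m n} {f g : Fin m → Fin n} → f ≗ g → Fin.funToFin f ≡ Fin.funToFin g
funToFin-cong {zero}  f≗g = refl
funToFin-cong {suc m} f≗g = cong₂ Fin.combine (f≗g zero) (funToFin-cong (f≗g ∘ suc))

encode-decode : ∀ {c n} (i : Fin (c ^ n)) → encode {c} {n} (decode i) ≡ i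
encode-decode {c} {n} i = trans
  (funToFin-cong (Vecₚ.lookup∘tabulate (Fin.finToFun {c} {n} i)))
  (Finₚ.funToFin-finToFin {n} {c} i)

decode-injective : ∀ {c n} {i j : Fin (c ^ n)} → decode {c} {n} i ≡ decode j → i ≡ j
decode-injective {c} {n} {i} {j} eq =
  trans (sym (encode-decode {c} {n} i)) (trans (cong encode eq) (encode-decode {c} {n} j))

encode-injective : ∀ {c n} {v w : Vec (Fin c) n} → encode v ≡ encode w → v ≡ w
encode-injective {v = v} {w} eq =
  trans (sym (decode-encode v)) (trans (cong decode eq) (decode-encode w))

^-cancelʳ-≤ : ∀ {m n} → 2 ^ m ≤ 2 ^ n → m ≤ n
^-cancelʳ-≤ {m} {n} 2^m≤2^n =
  ℕₚ.≮⇒≥ λ n<m → ℕₚ.<⇒≱ (ℕₚ.^-monoʳ-< 2 ℕₚ.≤-refl n<m) 2^m≤2^n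

bool : Fin 2 → Bool
bool = Inverse.to Finₚ.2↔Bool

digit : Bool → Fin 2
digit = Inverse.from Finₚ.2↔Bool

bool-digit : ∀ b → bool (digit b) ≡ b
bool-digit = Inverse.strictlyInverseˡ Finₚ.2↔Bool

digit-bool : ∀ i → digit (bool i) ≡ i
digit-bool = Inverse.strictlyInverseʳ Finₚ.2↔Bool

-- A factorization of the identity through 𝔽₂^q makes 𝔽₂^n → 𝔽₂^q injective.
identity-rank : ∀ {n} (L : Tensor (Fin n) (Fin n)) →
  (∀ a → ⟦ L ⟧ a a ≡ true) → (∀ a b → a ≢ b → ⟦ L ⟧ a b ≡ false) → n ≤ length L
identity-rank {n} L diag off = ^-cancelʳ-≤ (Finₚ.injective⇒≤ {f = image} image-injective)
  where
  vector : Fin (2 ^ n) → Fin n → Bool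
  vector i = bool ∘ Vec.lookup (decode {2} {n} i)

  -- `coords` applies the second factors of the terms to a vector and `rebuild` recombines the
  -- results with the first factors, so the composite is multiplication by the matrix `⟦ K ⟧`.
  coords : (K : Tensor (Fin n) (Fin n)) → (Fin n → Bool) → Vec (Fin 2) (length K)
  coords []            v = []
  coords ((f , g) ∷ K) v = digit (dot g v) ∷ coords K v

  rebuild : (K : Tensor (Fin n) (Fin n)) → Vec (Fin 2) (length K) → Fin n → Bool
  rebuild []            []       a = false
  rebuild ((f , g) ∷ K) (c ∷ cs) a = (f a ∧ bool c) xor rebuild K cs a

  rebuild-coords : ∀ K v a → rebuild K (coords K v) a ≡ dot (⟦ K ⟧ a) v
  rebuild-coords []            v a = sym (dot-zeroˡ v)
  rebuild-coords ((f , g) ∷ K) v a = trans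
    (cong₂ _xor_ (cong (f a ∧_) (bool-digit (dot g v))) (rebuild-coords K v a))
    (sym (dot-linearˡ (f a) g (⟦ K ⟧ a) v))

  rebuild-id : ∀ v a → rebuild L (coords L v) a ≡ v a
  rebuild-id v a =
    trans (rebuild-coords L v a) (dot-δ (⟦ L ⟧ a) v a (diag a) (off a))

  image : Fin (2 ^ n) → Fin (2 ^ length L)
  image i = encode (coords L (vector i))

  vector-injective : ∀ {i j} → vector i ≗ vector j → i ≡ j
  vector-injective {i} {j} eq = trans (sym (Finₚ.funToFin-finToFin {n} {2} i))
    (trans (funToFin-cong agree) (Finₚ.funToFin-finToFin {n} {2} j))
    where
    at : ∀ i a → digit (vector i a) ≡ Fin.finToFun {2} {n} i a
    at i a = trans (digit-bool _) (Vecₚ.lookup∘tabulate (Fin.finToFun {2} {n} i) a)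

    agree : Fin.finToFun {2} {n} i ≗ Fin.finToFun j
    agree a = trans (sym (at i a)) (trans (cong digit (eq a)) (at j a))

  image-injective : ∀ {i j} → image i ≡ image j → i ≡ j
  image-injective {i} {j} eq = vector-injective λ a →
    trans (sym (rebuild-id (vector i) a))
      (trans (cong (λ cs → rebuild L cs a) (encode-injective {v = coords L (vector i)} eq))
        (rebuild-id (vector j) a))

-- Words with blanks

-- The letter zero is a blank, which agrees with no letter, not even itself.
Word : ℕ → ℕ → Set
Word ℓ p = Vec (Fin (suc ℓ)) p

same : ∀ {ℓ} → Fin (suc ℓ) → Fin (suc ℓ) → Bool
same (suc x) (suc y) = does (x Finₚ.≟ y)
same _       _       = false

bit : Bool → ℕ
bit false = 0
bit true  = 1

agree : ∀ {ℓ p} → Word ℓ p → Word ℓ p → ℕ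
agree []       []       = 0
agree (x ∷ xs) (y ∷ ys) = bit (same x y) + agree xs ys

agree-≤ : ∀ {ℓ p} (v w : Word ℓ p) → agree v w ≤ p
agree-≤ []       []       = z≤n
agree-≤ (x ∷ xs) (y ∷ ys) = ℕₚ.+-mono-≤ (bit≤1 (same x y)) (agree-≤ xs ys)
  where
  bit≤1 : ∀ b → bit b ≤ 1
  bit≤1 false = z≤n
  bit≤1 true  = s≤s z≤n

full : ∀ {ℓ m} → Vec (Fin ℓ) m → Word ℓ m
full = Vec.map suc

-- Low-degree polynomials in the agreements

⟦⟧-tabulate : ∀ {n} (f : Fin n → X → Bool) (g : Fin n → Y → Bool) x y →
  ⟦ List.tabulate (λ i → f i , g i) ⟧ x y ≡ dot (λ i → f i x) (λ i → g i y)
⟦⟧-tabulate {n = zero}  f g x y = refl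
⟦⟧-tabulate {n = suc n} f g x y = cong ((f zero x ∧ g zero y) xor_) (⟦⟧-tabulate (f ∘ suc) (g ∘ suc) x y)

sameHead : ∀ {ℓ m} → Tensor (Vec (Fin ℓ) (suc m)) (Word ℓ (suc m))
sameHead = List.tabulate λ x →
  (λ a → does (Vec.head a Finₚ.≟ x)) , (λ w → same (suc x) (Vec.head w))

⟦sameHead⟧ : ∀ {ℓ m} (a : Vec (Fin ℓ) (suc m)) (w : Word ℓ (suc m)) →
  ⟦ sameHead ⟧ a w ≡ same (suc (Vec.head a)) (Vec.head w)
⟦sameHead⟧ {ℓ} a w = trans
  (⟦⟧-tabulate (λ x a → does (Vec.head a Finₚ.≟ x)) (λ x w → same (suc x) (Vec.head w)) a w)
  (dot-δ _ (λ x → same (suc x) (Vec.head w)) (Vec.head a)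
    (dec-true (Vec.head a Finₚ.≟ Vec.head a) refl)
    (λ b a≢b → dec-false (Vec.head a Finₚ.≟ b) a≢b))

-- One rank-one term for each set of fewer than j positions and each choice of
-- letters there on which the two words agree.
fewAgreements : ∀ {ℓ} m → ℕ → Tensor (Vec (Fin ℓ) m) (Word ℓ m)
fewAgreements m       zero    = []
fewAgreements zero    (suc j) = ((λ _ → true) , (λ _ → true)) ∷ []
fewAgreements (suc m) (suc j) =
  pull Vec.tail Vec.tail (fewAgreements m (suc j)) ++
  sameHead ⊙ pull Vec.tail Vec.tail (fewAgreements m j)

-- A set of positions either avoids the first one or contains it, and in the latter case it counts
-- only if the first letters agree. This is the recursion of `subsets₂`.
⟦fewAgreements⟧ : ∀ {ℓ m} j (a : Vec (Fin ℓ) m) w →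
  ⟦ fewAgreements m j ⟧ a w ≡ subsets₂ j (agree (full a) w)
⟦fewAgreements⟧ zero    a        w        = refl
⟦fewAgreements⟧ (suc j) []       []       = refl
⟦fewAgreements⟧ {m = suc m} (suc j) (x ∷ a) (y ∷ w) = begin
  ⟦ fewAgreements (suc m) (suc j) ⟧ (x ∷ a) (y ∷ w)
    ≡⟨ ⟦⟧-++ (pull Vec.tail Vec.tail (fewAgreements m (suc j))) _ (x ∷ a) (y ∷ w) ⟩
  ⟦ pull Vec.tail Vec.tail (fewAgreements m (suc j)) ⟧ (x ∷ a) (y ∷ w) xor
  ⟦ sameHead ⊙ pull Vec.tail Vec.tail (fewAgreements m j) ⟧ (x ∷ a) (y ∷ w)
    ≡⟨ cong₂ _xor_
         (trans (⟦⟧-pull Vec.tail Vec.tail (fewAgreements m (suc j)) (x ∷ a) (y ∷ w))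
                (⟦fewAgreements⟧ (suc j) a w))
         (trans (⟦⟧-⊙ sameHead (pull Vec.tail Vec.tail (fewAgreements m j)) (x ∷ a) (y ∷ w))
           (cong₂ _∧_ (⟦sameHead⟧ (x ∷ a) (y ∷ w))
             (trans (⟦⟧-pull Vec.tail Vec.tail (fewAgreements m j) (x ∷ a) (y ∷ w))
                    (⟦fewAgreements⟧ j a w)))) ⟩
  subsets₂ (suc j) s xor (same (suc x) y ∧ subsets₂ j s)
    ≡⟨ add (same (suc x) y) ⟩
  subsets₂ (suc j) (bit (same (suc x) y) + s) ∎
  where
  open ≡-Reasoning
  s : ℕ
  s = agree (full a) w
  add : ∀ b → subsets₂ (suc j) s xor (b ∧ subsets₂ j s) ≡ subsets₂ (suc j) (bit b + s)
  add false = 𝔹.xor-identityʳ _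
  add true  = refl

length-fewAgreements-suc : ∀ {ℓ} m j → length (fewAgreements {ℓ} (suc m) (suc j)) ≡
  length (fewAgreements {ℓ} m (suc j)) + ℓ * length (fewAgreements {ℓ} m j)
length-fewAgreements-suc {ℓ} m j = trans (Listₚ.length-++ (pull Vec.tail Vec.tail few))
  (cong₂ _+_ (Listₚ.length-map _ few)
    (trans (length-⊙ sameHead (pull Vec.tail Vec.tail fewer))
      (cong₂ _*_ (Listₚ.length-tabulate {n = ℓ} _) (Listₚ.length-map _ fewer))))
  where
  few fewer : Tensor (Vec (Fin ℓ) m) (Word ℓ m)
  few   = fewAgreements m (suc j)
  fewer = fewAgreements m j

-- There are at most 2^m sets of positions, and a set of at most `j` positions carries at most ℓ^j
-- choices of letters.
length-fewAgreements : ∀ {ℓ} .{{_ : ℕ.NonZero ℓ}} m j →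
  length (fewAgreements {ℓ} m (suc j)) ≤ 2 ^ m * ℓ ^ j
length-fewAgreements {ℓ} zero    j = ℕₚ.≤-trans (ℕₚ.m^n>0 ℓ j) (ℕₚ.m≤m+n (ℓ ^ j) 0)
length-fewAgreements {ℓ} (suc m) j = begin
  length (fewAgreements {ℓ} (suc m) (suc j))
    ≡⟨ length-fewAgreements-suc m j ⟩
  length (fewAgreements {ℓ} m (suc j)) + ℓ * length (fewAgreements {ℓ} m j)
    ≤⟨ ℕₚ.+-mono-≤ (length-fewAgreements m j) (fewer j) ⟩
  2 ^ m * ℓ ^ j + 2 ^ m * ℓ ^ j
    ≡⟨ ℕₚ.*-distribʳ-+ (ℓ ^ j) (2 ^ m) (2 ^ m) ⟨
  (2 ^ m + 2 ^ m) * ℓ ^ j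
    ≡⟨ cong (λ x → (2 ^ m + x) * ℓ ^ j) (ℕₚ.+-identityʳ (2 ^ m)) ⟨
  2 ^ suc m * ℓ ^ j ∎
  where
  open ℕₚ.≤-Reasoning
  fewer : ∀ j → ℓ * length (fewAgreements {ℓ} m j) ≤ 2 ^ m * ℓ ^ j
  fewer zero    = ℕₚ.≤-trans (ℕₚ.≤-reflexive (ℕₚ.*-zeroʳ ℓ)) z≤n
  fewer (suc j) = begin
    ℓ * length (fewAgreements {ℓ} m (suc j)) ≤⟨ ℕₚ.*-monoʳ-≤ ℓ (length-fewAgreements m j) ⟩
    ℓ * (2 ^ m * ℓ ^ j)                      ≡⟨ ℕₚ.*-assoc ℓ (2 ^ m) (ℓ ^ j) ⟨
    ℓ * 2 ^ m * ℓ ^ j                        ≡⟨ cong (_* ℓ ^ j) (ℕₚ.*-comm ℓ (2 ^ m)) ⟩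
    2 ^ m * ℓ * ℓ ^ j                        ≡⟨ ℕₚ.*-assoc (2 ^ m) ℓ (ℓ ^ j) ⟩
    2 ^ m * ℓ ^ suc j                        ∎

-- Column sums over the ways to blank out letters

subwordSum : ∀ {ℓ m} → Vec (Fin ℓ) m → (Word ℓ m → Bool) → Bool
subwordSum []      φ = φ []
subwordSum (b ∷ bs) φ =
  subwordSum bs (λ w → φ (suc b ∷ w)) xor subwordSum bs (λ w → φ (zero ∷ w))

subwordSum-cong : ∀ {ℓ m} (b : Vec (Fin ℓ) m) {φ ψ} → φ ≗ ψ → subwordSum b φ ≡ subwordSum b ψ
subwordSum-cong []       φ≗ψ = φ≗ψ []
subwordSum-cong (b ∷ bs) φ≗ψ =
  cong₂ _xor_ (subwordSum-cong bs (λ w → φ≗ψ (suc b ∷ w))) (subwordSum-cong bs (λ w → φ≗ψ (zero ∷ w)))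

subwordSum-zero : ∀ {ℓ m} (b : Vec (Fin ℓ) m) → subwordSum b (λ _ → false) ≡ false
subwordSum-zero []       = refl
subwordSum-zero (b ∷ bs) rewrite subwordSum-zero bs = refl

subwordSum-linear : ∀ {ℓ m} (b : Vec (Fin ℓ) m) c φ ψ →
  subwordSum b (λ w → (c ∧ φ w) xor ψ w) ≡ (c ∧ subwordSum b φ) xor subwordSum b ψ
subwordSum-linear []       c φ ψ = refl
subwordSum-linear (b ∷ bs) c φ ψ = begin
  subwordSum bs (λ w → (c ∧ φ (suc b ∷ w)) xor ψ (suc b ∷ w)) xor
  subwordSum bs (λ w → (c ∧ φ (zero ∷ w)) xor ψ (zero ∷ w))
    ≡⟨ cong₂ _xor_ (subwordSum-linear bs c _ _) (subwordSum-linear bs c _ _) ⟩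
  ((c ∧ S₁ φ) xor S₁ ψ) xor ((c ∧ S₀ φ) xor S₀ ψ)
    ≡⟨ xor-interchange (c ∧ S₁ φ) (S₁ ψ) (c ∧ S₀ φ) (S₀ ψ) ⟩
  ((c ∧ S₁ φ) xor (c ∧ S₀ φ)) xor (S₁ ψ xor S₀ ψ)
    ≡⟨ cong (_xor (S₁ ψ xor S₀ ψ)) (𝔹.∧-distribˡ-xor c (S₁ φ) (S₀ φ)) ⟨
  (c ∧ (S₁ φ xor S₀ φ)) xor (S₁ ψ xor S₀ ψ) ∎
  where
  open ≡-Reasoning
  S₁ S₀ : (Word _ _ → Bool) → Bool
  S₁ χ = subwordSum bs (λ w → χ (suc b ∷ w))
  S₀ χ = subwordSum bs (λ w → χ (zero ∷ w))

-- The new columns are linear combinations of old ones, so only the second factor of each term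
-- changes and the number of terms stays the same.
sumColumns : ∀ {ℓ m} → Tensor X (Word ℓ m) → Tensor X (Vec (Fin ℓ) m)
sumColumns = List.map λ (f , g) → f , λ b → subwordSum b g

⟦sumColumns⟧ : ∀ {ℓ m} (L : Tensor X (Word ℓ m)) x b →
  ⟦ sumColumns L ⟧ x b ≡ subwordSum b (⟦ L ⟧ x)
⟦sumColumns⟧ []            x b = sym (subwordSum-zero b)
⟦sumColumns⟧ ((f , g) ∷ L) x b = trans
  (cong ((f x ∧ subwordSum b g) xor_) (⟦sumColumns⟧ L x b))
  (sym (subwordSum-linear b (f x) g (⟦ L ⟧ x)))

-- Where a and b differ, filling in or blanking the letter of b gives the same
-- number of agreements with a, so the terms cancel in pairs.
subwordSum-agree-≢ : ∀ {ℓ m} (a b : Vec (Fin ℓ) m) (e : ℕ → Bool) → a ≢ b →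
  subwordSum b (λ w → e (agree (full a) w)) ≡ false
subwordSum-agree-≢ []      []      e a≢b = contradiction refl a≢b
subwordSum-agree-≢ (x ∷ a) (y ∷ b) e a≢b with x Finₚ.≟ y
... | no  _    = 𝔹.xor-same (subwordSum b (λ w → e (agree (full a) w)))
... | yes refl = cong₂ _xor_ (subwordSum-agree-≢ a b (e ∘ suc) (a≢b ∘ cong (x ∷_)))
                             (subwordSum-agree-≢ a b e (a≢b ∘ cong (x ∷_)))

-- A subword of `a` agrees with `a` exactly at its unblanked positions, so the sum counts the
-- `j`-element sets of positions modulo 2.
subwordSum-agree-≡ : ∀ {ℓ m} (a : Vec (Fin ℓ) m) j →
  subwordSum a (λ w → agree (full a) w ≡ᵇ j) ≡ binom₂ m j
subwordSum-agree-≡ []      zero    = refl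
subwordSum-agree-≡ []      (suc j) = refl
subwordSum-agree-≡ {m = suc m} (x ∷ a) j rewrite dec-true (x Finₚ.≟ x) refl with j
... | zero  = cong₂ _xor_ (subwordSum-zero a) (trans (subwordSum-agree-≡ a zero) (binom₂-zero m))
... | suc i = trans (cong₂ _xor_ (subwordSum-agree-≡ a i) (subwordSum-agree-≡ a (suc i)))
                    (𝔹.xor-comm (binom₂ m i) (binom₂ m (suc i)))

≡ᵇ-true : ∀ {m n} → m ≡ n → (m ≡ᵇ n) ≡ true
≡ᵇ-true {zero}  refl = refl
≡ᵇ-true {suc m} refl = ≡ᵇ-true {m} refl

≡ᵇ-false : ∀ {m n} → m ≢ n → (m ≡ᵇ n) ≡ false
≡ᵇ-false {m} {n} m≢n = dec-false (m ℕₚ.≟ n) m≢n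

-- Rank of the completions over 𝔽₂

module _ {ℓ k′ : ℕ} .{{_ : ℕ.NonZero ℓ}} (F : Frobenius (suc k′)) where
  private
    k m : ℕ
    k = suc k′
    -- Length 2k - 1 keeps every agreement count below 2k, as `subsets₂-vanishes` requires, and
    -- makes C(m, k) odd.
    m = k + k′

  -- fewAgreements m k vanishes on the wildcards, so its product with any
  -- completion is known.
  masked : (L : Tensor (Vec (Fin ℓ) m) (Word ℓ m)) →
    (∀ a w → agree (full a) w ≡ 0 → ⟦ L ⟧ a w ≡ false) →
    (∀ a w → agree (full a) w ≡ k → ⟦ L ⟧ a w ≡ true) →
    ∀ a w → ⟦ fewAgreements m k ⊙ L ⟧ a w ≡ (agree (full a) w ≡ᵇ k)
  masked L L-0 L-k a w rewrite ⟦⟧-⊙ (fewAgreements m k) L a w | ⟦fewAgreements⟧ k a w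
    with agree (full a) w ℕₚ.≟ 0 | agree (full a) w ℕₚ.≟ k
  -- Here the polynomial is 1, and the zero comes from `L`.
  ... | yes s≡0 | _ rewrite L-0 a w s≡0 | s≡0 = refl
  ... | no _ | yes s≡k rewrite L-k a w s≡k | s≡k
                             | subsets₂-suc k′ k′ | binom₂-diag k′ = sym (≡ᵇ-true {k} refl)
  ... | no s≢0 | no s≢k
    rewrite subsets₂-vanishes F (agree (full a) w) s≢0 s≢k
              (ℕₚ.≤-<-trans (agree-≤ (full a) w) (ℕₚ.+-monoʳ-< k (ℕₚ.n<1+n k′))) =
      sym (≡ᵇ-false s≢k)

  -- The column sums of the masked product form the identity matrix of size ℓ^m, while its number of
  -- terms is the product of the two lengths.
  completion-rank : (L : Tensor (Vec (Fin ℓ) m) (Word ℓ m)) →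
    (∀ a w → agree (full a) w ≡ 0 → ⟦ L ⟧ a w ≡ false) →
    (∀ a w → agree (full a) w ≡ k → ⟦ L ⟧ a w ≡ true) →
    ℓ ^ m ≤ (2 ^ m * ℓ ^ k′) * length L
  completion-rank L L-0 L-k = begin
    ℓ ^ m                                   ≤⟨ identity-rank I I-diag I-off ⟩
    length I                                ≡⟨ Listₚ.length-map _ (sumColumns K) ⟩
    length (sumColumns K)                   ≡⟨ Listₚ.length-map _ K ⟩
    length K                                ≡⟨ length-⊙ (fewAgreements m k) L ⟩
    length (fewAgreements m k) * length L   ≤⟨ ℕₚ.*-monoˡ-≤ (length L) (length-fewAgreements m k′) ⟩
    (2 ^ m * ℓ ^ k′) * length L             ∎
    where
    open ℕₚ.≤-Reasoning
    K : Tensor (Vec (Fin ℓ) m) (Word ℓ m)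
    K = fewAgreements m k ⊙ L
    word : Fin (ℓ ^ m) → Vec (Fin ℓ) m
    word = decode
    I : Tensor (Fin (ℓ ^ m)) (Fin (ℓ ^ m))
    I = pull word word (sumColumns K)
    I-sum : ∀ a b → ⟦ I ⟧ a b ≡ subwordSum (word b) (λ w → agree (full (word a)) w ≡ᵇ k)
    I-sum a b = trans (⟦⟧-pull word word (sumColumns K) a b)
      (trans (⟦sumColumns⟧ K (word a) (word b))
        (subwordSum-cong (word b) (masked L L-0 L-k (word a))))
    I-diag : ∀ a → ⟦ I ⟧ a a ≡ true
    I-diag a = trans (I-sum a a) (trans (subwordSum-agree-≡ (word a) k) (binom₂-odd F))
    I-off : ∀ a b → a ≢ b → ⟦ I ⟧ a b ≡ false
    I-off a b a≢b = trans (I-sum a b)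
      (subwordSum-agree-≢ (word a) (word b) (_≡ᵇ k) (a≢b ∘ decode-injective {ℓ} {m}))

-- The partial matrices

identityEntry : ∀ {n} → Fin n → Fin n → Entry
identityEntry i j = if does (i Finₚ.≟ j) then 𝟏 else 𝟎

countEntry : ℕ → ℕ → Entry
countEntry k s = if s ≡ᵇ 0 then 𝟎 else if s ≡ᵇ k then 𝟏 else ⋆

countEntry-0 : ∀ k {s} → s ≡ 0 → countEntry k s ≡ 𝟎
countEntry-0 k refl = refl

countEntry-k : ∀ {k s} .{{_ : ℕ.NonZero k}} → s ≡ k → countEntry k s ≡ 𝟏
countEntry-k {suc k} refl rewrite ≡ᵇ-true {k} refl = refl

-- The identity block forces nonnegative rank at least n. The mixed blocks are wildcards, so
-- factorizations of the two diagonal blocks with n terms each can be stacked at no extra cost.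
blockEntry : ∀ {ℓ p n} → ℕ → Fin n ⊎ Word ℓ p → Fin n ⊎ Word ℓ p → Entry
blockEntry k (inj₁ i) (inj₁ j) = identityEntry i j
blockEntry k (inj₂ v) (inj₂ w) = countEntry k (agree v w)
blockEntry k _        _        = ⋆

-- Rows and columns are indexed alike: first one unit line for each pair of a position and a letter,
-- then all words.
lines : ℕ → ℕ → ℕ
lines ℓ p = p * ℓ + suc ℓ ^ p

line : ∀ {ℓ p} → Fin (lines ℓ p) → Fin (p * ℓ) ⊎ Word ℓ p
line {ℓ} {p} = Sum.map₂ decode ∘ Fin.splitAt (p * ℓ)

unitLine : ∀ {ℓ p} → Fin (p * ℓ) → Fin (lines ℓ p)
unitLine {ℓ} {p} i = i Fin.↑ˡ (suc ℓ ^ p)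

wordLine : ∀ {ℓ p} → Word ℓ p → Fin (lines ℓ p)
wordLine {ℓ} {p} w = (p * ℓ) Fin.↑ʳ encode w

line-unitLine : ∀ {ℓ p} i → line {ℓ} {p} (unitLine {ℓ} {p} i) ≡ inj₁ i
line-unitLine {ℓ} {p} i = cong (Sum.map₂ decode) (Finₚ.splitAt-↑ˡ (p * ℓ) i (suc ℓ ^ p))

line-wordLine : ∀ {ℓ p} (w : Word ℓ p) → line (wordLine w) ≡ inj₂ w
line-wordLine {ℓ} {p} w = trans
  (cong (Sum.map₂ decode) (Finₚ.splitAt-↑ʳ (p * ℓ) (suc ℓ ^ p) (encode w)))
  (cong inj₂ (decode-encode w))

agreementMatrix : ℕ → ℕ → ℕ → PartialMatrix
agreementMatrix ℓ p k = mkPartial (lines ℓ p) (lines ℓ p) λ i j →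
  blockEntry k (line {ℓ} {p} i) (line {ℓ} {p} j)

-- Binary rank

-- The completion is not a separate datum; it is the product of the factors.
Factors₀₁ : PartialMatrix → ℕ → Set
Factors₀₁ M r = Σ (Matrix ℕ (rows M) r) λ U → Σ (Matrix ℕ r (cols M)) λ V →
  Binary U × Binary V × (∀ i j → Agreesℕ (entry M i j) (mulℕ U V i j))

-- Existence of the binary rank by exhaustive search

Searchable : Set → Set₁
Searchable A = ∀ {P : A → Set} → (∀ a → Dec (P a)) → Dec (∃[ a ] P a)

searchBool : Searchable Bool
searchBool P? with P? true | P? false
... | yes p | _     = yes (true , p)
... | no _  | yes p = yes (false , p)
... | no ¬t | no ¬f = no λ { (true , p) → ¬t p ; (false , p) → ¬f p }

searchVec : ∀ {A : Set} → Searchable A → ∀ {n} → Searchable (Vec A n)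
searchVec search {zero}  P? = map′ ([] ,_) (λ { ([] , p) → p }) (P? [])
searchVec search {suc n} P? = map′
  (λ (x , xs , p) → x ∷ xs , p) (λ { (x ∷ xs , p) → x , xs , p })
  (search λ x → searchVec search λ xs → P? (x ∷ xs))

bits : ∀ {n m} → Vec (Vec Bool m) n → Matrix ℕ n m
bits u i j = bit (Vec.lookup (Vec.lookup u i) j)

bits-binary : ∀ {n m} (u : Vec (Vec Bool m) n) → Binary (bits u)
bits-binary u i j with Vec.lookup (Vec.lookup u i) j
... | false = inj₁ refl
... | true  = inj₂ refl

fromBinary : ∀ {n m} → Matrix ℕ n m → Vec (Vec Bool m) n
fromBinary U = Vec.tabulate λ i → Vec.tabulate λ j → U i j ≡ᵇ 1

bits-fromBinary : ∀ {n m} {U : Matrix ℕ n m} → Binary U → ∀ i j → bits (fromBinary U) i j ≡ U i j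
bits-fromBinary {U = U} bin i j
  rewrite Vecₚ.lookup∘tabulate (λ i → Vec.tabulate λ j → U i j ≡ᵇ 1) i
        | Vecₚ.lookup∘tabulate (λ j → U i j ≡ᵇ 1) j with bin i j
... | inj₁ U≡0 rewrite U≡0 = refl
... | inj₂ U≡1 rewrite U≡1 = refl

sum : ∀ {n} → (Fin n → ℕ) → ℕ
sum = VF.foldr _+_ 0

sum-cong : ∀ {n} {f g : Fin n → ℕ} → f ≗ g → sum f ≡ sum g
sum-cong {zero}  f≗g = refl
sum-cong {suc n} f≗g = cong₂ _+_ (f≗g zero) (sum-cong (f≗g ∘ suc))

agreesℕ? : ∀ e x → Dec (Agreesℕ e x)
agreesℕ? 𝟎 x = x ℕₚ.≟ 0
agreesℕ? 𝟏 x = x ℕₚ.≟ 1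
agreesℕ? ⋆ x = yes _

-- Only finitely many pairs of binary factors have the given sizes. The search runs over Boolean
-- vectors, which, unlike functions, are determined by their entries up to `_≡_`.
factors₀₁? : ∀ M r → Dec (Factors₀₁ M r)
factors₀₁? M r = map′
  (λ (u , v , h) → bits u , bits v , bits-binary u , bits-binary v , h)
  (λ (U , V , binU , binV , h) → fromBinary U , fromBinary V , λ i j →
    subst (Agreesℕ (entry M i j))
      (sum-cong λ q → sym (cong₂ _*_ (bits-fromBinary binU i q) (bits-fromBinary binV q j)))
      (h i j))
  (searchVec (searchVec searchBool) λ u → searchVec (searchVec searchBool) λ v →
    Finₚ.all? λ i → Finₚ.all? λ j → agreesℕ? (entry M i j) (mulℕ (bits u) (bits v) i j))

𝟙 : ∀ {n} → Matrix ℕ n n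
𝟙 i j = bit (does (i Finₚ.≟ j))

sum-zero : ∀ {n} {f : Fin n → ℕ} → (∀ i → f i ≡ 0) → sum f ≡ 0
sum-zero {zero}  f≡0 = refl
sum-zero {suc n} f≡0 = cong₂ _+_ (f≡0 zero) (sum-zero (f≡0 ∘ suc))

sum-𝟙 : ∀ {n} i (f : Fin n → ℕ) → sum (λ q → 𝟙 i q * f q) ≡ f i
sum-𝟙 {suc n} zero    f = trans
  (cong₂ _+_ (ℕₚ.*-identityˡ (f zero)) (sum-zero {n} λ _ → refl)) (ℕₚ.+-identityʳ (f zero))
sum-𝟙 {suc n} (suc i) f = sum-𝟙 i (f ∘ suc)

-- The identity times the matrix with its wildcards set to 0; this bounds the search for the
-- minimum.
trivialFactors₀₁ : ∀ M → Factors₀₁ M (rows M)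
trivialFactors₀₁ M = 𝟙 , V , (λ i j → bit-binary (does (i Finₚ.≟ j))) , V-binary , λ i j →
  subst (Agreesℕ (entry M i j)) (sym (sum-𝟙 i λ q → V q j)) (agrees (entry M i j))
  where
  value : Entry → ℕ
  value 𝟎 = 0
  value 𝟏 = 1
  value ⋆ = 0
  V : Matrix ℕ (rows M) (cols M)
  V i j = value (entry M i j)
  bit-binary : ∀ b → bit b ≡ 0 ⊎ bit b ≡ 1
  bit-binary false = inj₁ refl
  bit-binary true  = inj₂ refl
  V-binary : Binary V
  V-binary i j with entry M i j
  ... | 𝟎 = inj₁ refl
  ... | 𝟏 = inj₂ refl
  ... | ⋆ = inj₁ refl
  agrees : ∀ e → Agreesℕ e (value e)
  agrees 𝟎 = refl
  agrees 𝟏 = refl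
  agrees ⋆ = _

least : ∀ {P : ℕ → Set} → (∀ r → Dec (P r)) → ∀ n → P n → ∃[ r ] IsMinimum P r
least P? zero    p = 0 , p , λ _ _ → z≤n
least P? (suc n) p with P? 0
... | yes p₀ = 0 , p₀ , λ _ _ → z≤n
... | no ¬p₀ with least (P? ∘ suc) n p
...   | r , pr , min = suc r , pr , λ
  { zero    p₀ → contradiction p₀ ¬p₀
  ; (suc s) ps → s≤s (min s ps) }

minimalFactors₀₁ : ∀ M → ∃[ r ] IsMinimum (Factors₀₁ M) r
minimalFactors₀₁ M = least (factors₀₁? M) (rows M) (trivialFactors₀₁ M)

-- The minimum over completions of a minimum over factorizations is a single minimum over factor
-- pairs, and the product of an optimal pair is an optimal completion.
isRank₀₁ : ∀ M {r} → IsMinimum (Factors₀₁ M) r → IsRank₀₁ M r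
isRank₀₁ M {r} ((U , V , binU , binV , h) , min) =
  (mulℕ U V , h , (U , V , binU , binV , λ _ _ → refl) ,
    λ s (U′ , V′ , binU′ , binV′ , eq) → min s (U′ , V′ , binU′ , binV′ , λ i j →
      subst (Agreesℕ (entry M i j)) (eq i j) (h i j))) ,
  λ s (N , agr , (U′ , V′ , binU′ , binV′ , eq) , _) → min s (U′ , V′ , binU′ , binV′ , λ i j →
    subst (Agreesℕ (entry M i j)) (eq i j) (agr i j))

-- Reduction modulo 2 and the exponential lower bound

odd : ℕ → Bool
odd zero    = false
odd (suc n) = not (odd n)

odd-+ : ∀ m n → odd (m + n) ≡ odd m xor odd n
odd-+ zero    n = refl
odd-+ (suc m) n = trans (cong not (odd-+ m n)) (𝔹.not-distribˡ-xor (odd m) (odd n))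

odd-* : ∀ m n → odd (m * n) ≡ odd m ∧ odd n
odd-* zero    n = refl
odd-* (suc m) n = trans (odd-+ n (m * n)) (trans (cong (odd n xor_) (odd-* m n)) (absorb (odd m) (odd n)))
  where
  absorb : ∀ b c → c xor (b ∧ c) ≡ not b ∧ c
  absorb false c = 𝔹.xor-identityʳ c
  absorb true  c = 𝔹.xor-same c

odd-sum : ∀ {n} (f g : Fin n → ℕ) →
  odd (sum (λ q → f q * g q)) ≡ dot (odd ∘ f) (odd ∘ g)
odd-sum {zero}  f g = refl
odd-sum {suc n} f g = trans (odd-+ (f zero * g zero) _)
  (cong₂ _xor_ (odd-* (f zero) (g zero)) (odd-sum (f ∘ suc) (g ∘ suc)))

-- A blank first letter embeds the words of length 2k − 1 into those of length 2k.
factors₀₁-bound : ∀ {ℓ k′ s} .{{_ : ℕ.NonZero ℓ}} → Frobenius (suc k′) →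
  Factors₀₁ (agreementMatrix ℓ (suc (suc k′ + k′)) (suc k′)) s →
  ℓ ^ (suc k′ + k′) ≤ (2 ^ (suc k′ + k′) * ℓ ^ k′) * s
factors₀₁-bound {ℓ} {k′} {s} F (U , V , _ , _ , h) =
  subst (λ q → ℓ ^ m ≤ (2 ^ m * ℓ ^ k′) * q) (Listₚ.length-tabulate {n = s} _)
    (completion-rank F L L-0 L-k)
  where
  k m : ℕ
  k = suc k′
  m = k + k′
  rowOf : Vec (Fin ℓ) m → Fin (lines ℓ (suc m))
  rowOf a = wordLine (zero ∷ full a)
  colOf : Word ℓ m → Fin (lines ℓ (suc m))
  colOf w = wordLine (zero ∷ w)
  -- The factors modulo 2, one rank-one term per inner index, restricted to rows whose only blank is
  -- the leading one.
  L : Tensor (Vec (Fin ℓ) m) (Word ℓ m)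
  L = List.tabulate λ q → (λ a → odd (U (rowOf a) q)) , (λ w → odd (V q (colOf w)))
  ⟦L⟧ : ∀ a w → ⟦ L ⟧ a w ≡ odd (mulℕ U V (rowOf a) (colOf w))
  ⟦L⟧ a w = trans
    (⟦⟧-tabulate (λ q a → odd (U (rowOf a) q)) (λ q w → odd (V q (colOf w))) a w)
    (sym (odd-sum (U (rowOf a)) (λ q → V q (colOf w))))
  agrees : ∀ a w → Agreesℕ (countEntry k (agree (full a) w)) (mulℕ U V (rowOf a) (colOf w))
  agrees a w = subst (λ e → Agreesℕ e (mulℕ U V (rowOf a) (colOf w)))
    (cong₂ (blockEntry k) (line-wordLine (zero ∷ full a)) (line-wordLine (zero ∷ w)))
    (h (rowOf a) (colOf w))
  L-0 : ∀ a w → agree (full a) w ≡ 0 → ⟦ L ⟧ a w ≡ false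
  L-0 a w s≡0 = trans (⟦L⟧ a w)
    (cong odd (subst (λ e → Agreesℕ e (mulℕ U V (rowOf a) (colOf w))) (countEntry-0 k s≡0) (agrees a w)))
  L-k : ∀ a w → agree (full a) w ≡ k → ⟦ L ⟧ a w ≡ true
  L-k a w s≡k = trans (⟦L⟧ a w)
    (cong odd (subst (λ e → Agreesℕ e (mulℕ U V (rowOf a) (colOf w))) (countEntry-k {k} s≡k) (agrees a w)))

-- With m = 2k - 1, cancelling ℓ^(k - 1) leaves ℓ^k ≤ 2^m s. As ℓ ≥ 2^4, the left side is at least
-- 2^(4k), which exceeds 2^m · 2^(m + 1) = 2^(4k - 1).
factors₀₁-exponential : ∀ {ℓ k′ s} → Frobenius (suc k′) → 16 ≤ ℓ →
  Factors₀₁ (agreementMatrix ℓ (suc (suc k′ + k′)) (suc k′)) s →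
  2 ^ suc (suc k′ + k′) ≤ s
factors₀₁-exponential {ℓ} {k′} {s} F 16≤ℓ fac =
  ℕₚ.*-cancelˡ-≤ (2 ^ m) {{ℕₚ.m^n≢0 2 m}} (ℕₚ.*-cancelˡ-≤ (ℓ ^ k′) {{ℕₚ.m^n≢0 ℓ k′}} (begin
    ℓ ^ k′ * (2 ^ m * 2 ^ suc m)   ≤⟨ ℕₚ.*-monoʳ-≤ (ℓ ^ k′) base ⟩
    ℓ ^ k′ * ℓ ^ k                 ≡⟨ ℕₚ.^-distribˡ-+-* ℓ k′ k ⟨
    ℓ ^ (k′ + k)                   ≡⟨ cong (ℓ ^_) (ℕₚ.+-comm k′ k) ⟩
    ℓ ^ m                          ≤⟨ factors₀₁-bound F fac ⟩
    (2 ^ m * ℓ ^ k′) * s           ≡⟨ cong (_* s) (ℕₚ.*-comm (2 ^ m) (ℓ ^ k′)) ⟩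
    (ℓ ^ k′ * 2 ^ m) * s           ≡⟨ ℕₚ.*-assoc (ℓ ^ k′) (2 ^ m) s ⟩
    ℓ ^ k′ * (2 ^ m * s)           ∎))
  where
  open ℕₚ.≤-Reasoning
  k m : ℕ
  k = suc k′
  m = k + k′
  instance
    ℓ≢0 : ℕ.NonZero ℓ
    ℓ≢0 = ℕ.>-nonZero (ℕₚ.≤-trans (s≤s z≤n) 16≤ℓ)
  base : 2 ^ m * 2 ^ suc m ≤ ℓ ^ k
  base = begin
    2 ^ m * 2 ^ suc m ≡⟨ ℕₚ.^-distribˡ-+-* 2 m (suc m) ⟨
    2 ^ (m + suc m)   ≤⟨ ℕₚ.^-monoʳ-≤ 2 (ℕₚ.≤-trans (ℕₚ.n≤1+n (m + suc m)) (ℕₚ.≤-reflexive (exponent k′))) ⟩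
    2 ^ (4 * k)       ≡⟨ ℕₚ.^-*-assoc 2 4 k ⟨
    16 ^ k            ≤⟨ ℕₚ.^-monoˡ-≤ k 16≤ℓ ⟩
    ℓ ^ k             ∎
    where
    exponent : ∀ i → suc ((suc i + i) + suc (suc i + i)) ≡ 4 * suc i
    exponent = solve 1 (λ i → con 1 :+ (con 1 :+ i :+ i :+ (con 1 :+ (con 1 :+ i :+ i))) := con 4 :* (con 1 :+ i)) refl
      where open ℕ-Solver.+-*-Solver

-- Nonnegative factorizations of the identity

module _ where
  open ℚ-Solver.+-*-Solver

  -- Reduces an inequality to a known one and a linear identity that the ring solver can check.
  ≤-rearrange : ∀ {a b c d} → a ℚ.≤ b → c ℚ.+ b ≡ d ℚ.+ a → c ℚ.≤ d
  ≤-rearrange {a} {b} {c} {d} a≤b eq = begin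
    c               ≡⟨ cancel c b ⟨
    (c ℚ.+ b) ℚ.- b ≡⟨ cong (ℚ._- b) eq ⟩
    (d ℚ.+ a) ℚ.- b ≤⟨ ℚₚ.+-monoˡ-≤ (ℚ.- b) (ℚₚ.+-monoʳ-≤ d a≤b) ⟩
    (d ℚ.+ b) ℚ.- b ≡⟨ cancel d b ⟩
    d               ∎
    where
    open ℚₚ.≤-Reasoning
    cancel : ∀ x y → (x ℚ.+ y) ℚ.- y ≡ x
    cancel = solve 2 (λ x y → (x :+ y) :- y := x) refl

  p≤∣p∣ : ∀ p → p ℚ.≤ ℚ.∣ p ∣
  p≤∣p∣ p with ℚₚ.∣p∣≡p∨∣p∣≡-p p
  ... | inj₁ eq = ℚₚ.≤-reflexive (sym eq)
  ... | inj₂ eq = ℚₚ.≤-trans (≤-rearrange (subst (0ℚ ℚ.≤_) eq (ℚₚ.0≤∣p∣ p))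
    (solve 1 (λ p → p :+ (:- p) := con 0ℚ :+ con 0ℚ) refl p)) (ℚₚ.0≤∣p∣ p)

  ∣p-q∣≤r⇒p≤q+r : ∀ {p q r} → ℚ.∣ p ℚ.- q ∣ ℚ.≤ r → p ℚ.≤ q ℚ.+ r
  ∣p-q∣≤r⇒p≤q+r {p} {q} {r} h = ≤-rearrange (ℚₚ.≤-trans (p≤∣p∣ (p ℚ.- q)) h)
    (solve 3 (λ p q r → p :+ r := (q :+ r) :+ (p :- q)) refl p q r)

  ∣p-q∣≡∣q-p∣ : ∀ p q → ℚ.∣ p ℚ.- q ∣ ≡ ℚ.∣ q ℚ.- p ∣
  ∣p-q∣≡∣q-p∣ p q = trans (sym (ℚₚ.∣-p∣≡∣p∣ (p ℚ.- q)))
    (cong ℚ.∣_∣ (solve 2 (λ p q → :- (p :- q) := q :- p) refl p q))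

  ∣p∣≤q : ∀ {p q} → p ℚ.≤ q → ℚ.- p ℚ.≤ q → ℚ.∣ p ∣ ℚ.≤ q
  ∣p∣≤q {p} p≤q -p≤q with ℚₚ.∣p∣≡p∨∣p∣≡-p p
  ... | inj₁ eq = subst (ℚ._≤ _) (sym eq) p≤q
  ... | inj₂ eq = subst (ℚ._≤ _) (sym eq) -p≤q

  half : ℚ → ℚ
  half ε = ε ℚ.* ½

  half+half : ∀ ε → half ε ℚ.+ half ε ≡ ε
  half+half ε = trans (sym (ℚₚ.*-distribˡ-+ ε ½ ½)) (ℚₚ.*-identityʳ ε)

  0<* : ∀ {p q} → 0ℚ ℚ.< p → 0ℚ ℚ.< q → 0ℚ ℚ.< p ℚ.* q
  0<* {p} {q} 0<p 0<q =
    ℚₚ.positive⁻¹ (p ℚ.* q) {{ℚₚ.pos*pos⇒pos p {{ℚ.positive 0<p}} q {{ℚ.positive 0<q}}}}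

  0≤* : ∀ {p q} → 0ℚ ℚ.≤ p → 0ℚ ℚ.≤ q → 0ℚ ℚ.≤ p ℚ.* q
  0≤* {p} {q} 0≤p 0≤q = ℚₚ.nonNegative⁻¹ (p ℚ.* q)
    {{ℚₚ.nonNeg*nonNeg⇒nonNeg p {{ℚ.nonNegative 0≤p}} q {{ℚ.nonNegative 0≤q}}}}

  0<half : ∀ {ε} → 0ℚ ℚ.< ε → 0ℚ ℚ.< half ε
  0<half 0<ε = 0<* 0<ε (ℚₚ.positive⁻¹ ½)

  *-mono-≤ : ∀ {a b c d} → 0ℚ ℚ.≤ c → 0ℚ ℚ.≤ b →
             a ℚ.≤ b → c ℚ.≤ d → a ℚ.* c ℚ.≤ b ℚ.* d
  *-mono-≤ {b = b} {c} 0≤c 0≤b a≤b c≤d = ℚₚ.≤-trans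
    (ℚₚ.*-monoʳ-≤-nonNeg c {{ℚ.nonNegative 0≤c}} a≤b)
    (ℚₚ.*-monoˡ-≤-nonNeg b {{ℚ.nonNegative 0≤b}} c≤d)

  -- Equality and order of the reals

  ≃-sym : ∀ {x y} → x ≃ y → y ≃ x
  ≃-sym {x} {y} x≃y ε 0<ε = let (N , h) = x≃y ε 0<ε in
    N , λ n N≤n → subst (ℚ._≤ ε) (∣p-q∣≡∣q-p∣ (seq x n) (seq y n)) (h n N≤n)

  ≃-trans : ∀ {x y z} → x ≃ y → y ≃ z → x ≃ z
  ≃-trans {x} {y} {z} x≃y y≃z ε 0<ε =
    let (N₁ , h₁) = x≃y (half ε) (0<half 0<ε)
        (N₂ , h₂) = y≃z (half ε) (0<half 0<ε)
    in N₁ ℕ.⊔ N₂ , λ n N≤n → begin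
      ℚ.∣ seq x n ℚ.- seq z n ∣
        ≡⟨ cong ℚ.∣_∣ (solve 3 (λ x y z → x :- z := (x :- y) :+ (y :- z)) refl (seq x n) (seq y n) (seq z n)) ⟩
      ℚ.∣ (seq x n ℚ.- seq y n) ℚ.+ (seq y n ℚ.- seq z n) ∣
        ≤⟨ ℚₚ.∣p+q∣≤∣p∣+∣q∣ (seq x n ℚ.- seq y n) (seq y n ℚ.- seq z n) ⟩
      ℚ.∣ seq x n ℚ.- seq y n ∣ ℚ.+ ℚ.∣ seq y n ℚ.- seq z n ∣
        ≤⟨ ℚₚ.+-mono-≤ (h₁ n (ℕₚ.m⊔n≤o⇒m≤o N₁ N₂ N≤n)) (h₂ n (ℕₚ.m⊔n≤o⇒n≤o N₁ N₂ N≤n)) ⟩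
      half ε ℚ.+ half ε
        ≡⟨ half+half ε ⟩
      ε ∎
    where open ℚₚ.≤-Reasoning

  +ᴿ-mono-≤ᴿ : ∀ {x y z w} → x ≤ᴿ y → z ≤ᴿ w → x +ᴿ z ≤ᴿ y +ᴿ w
  +ᴿ-mono-≤ᴿ {x} {y} {z} {w} x≤y z≤w ε 0<ε =
    let (N₁ , h₁) = x≤y (half ε) (0<half 0<ε)
        (N₂ , h₂) = z≤w (half ε) (0<half 0<ε)
    in N₁ ℕ.⊔ N₂ , λ n N≤n → begin
      seq x n ℚ.+ seq z n
        ≤⟨ ℚₚ.+-mono-≤ (h₁ n (ℕₚ.m⊔n≤o⇒m≤o N₁ N₂ N≤n)) (h₂ n (ℕₚ.m⊔n≤o⇒n≤o N₁ N₂ N≤n)) ⟩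
      (seq y n ℚ.+ half ε) ℚ.+ (seq w n ℚ.+ half ε)
        ≡⟨ solve 3 (λ y w h → (y :+ h) :+ (w :+ h) := (y :+ w) :+ (h :+ h)) refl (seq y n) (seq w n) (half ε) ⟩
      (seq y n ℚ.+ seq w n) ℚ.+ (half ε ℚ.+ half ε)
        ≡⟨ cong (seq y n ℚ.+ seq w n ℚ.+_) (half+half ε) ⟩
      (seq y n ℚ.+ seq w n) ℚ.+ ε ∎
    where open ℚₚ.≤-Reasoning

  ≤ᴿ-refl : ∀ {x} → x ≤ᴿ x
  ≤ᴿ-refl {x} ε 0<ε = 0 , λ n _ → ≤-rearrange (ℚₚ.<⇒≤ 0<ε)
    (solve 2 (λ x e → x :+ e := (x :+ e) :+ con 0ℚ) refl (seq x n) ε)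

  ≤ᴿ-respˡ : ∀ {x x′ y} → seq x ≗ seq x′ → x ≤ᴿ y → x′ ≤ᴿ y
  ≤ᴿ-respˡ {y = y} eq x≤y ε 0<ε = let (N , h) = x≤y ε 0<ε in
    N , λ n N≤n → subst (ℚ._≤ seq y n ℚ.+ ε) (eq n) (h n N≤n)

  sumᴿ : ∀ {n} → (Fin n → ℝ) → ℝ
  sumᴿ = VF.foldr _+ᴿ_ 0ℝ

  sumᴿ-nonneg : ∀ {n} {w : Fin n → ℝ} → (∀ i → 0ℝ ≤ᴿ w i) → 0ℝ ≤ᴿ sumᴿ w
  sumᴿ-nonneg {zero}  w≥0 = ≤ᴿ-refl {0ℝ}
  sumᴿ-nonneg {suc n} {w} w≥0 = 
    +ᴿ-mono-≤ᴿ {0ℝ} {w zero} {0ℝ} {sumᴿ (w ∘ suc)} (w≥0 zero) (sumᴿ-nonneg {w = w ∘ suc} (w≥0 ∘ suc))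

  term-≤ᴿ-sumᴿ : ∀ {n} {w : Fin n → ℝ} → (∀ i → 0ℝ ≤ᴿ w i) → ∀ i → w i ≤ᴿ sumᴿ w
  term-≤ᴿ-sumᴿ {suc n} {w} w≥0 zero =
    ≤ᴿ-respˡ {w zero +ᴿ 0ℝ} {w zero} {sumᴿ w} (λ t → ℚₚ.+-identityʳ (seq (w zero) t))
      (+ᴿ-mono-≤ᴿ {w zero} {w zero} {0ℝ} {sumᴿ (w ∘ suc)} (≤ᴿ-refl {w zero})
        (sumᴿ-nonneg {w = w ∘ suc} (w≥0 ∘ suc)))
  term-≤ᴿ-sumᴿ {suc n} {w} w≥0 (suc i) =
    ≤ᴿ-respˡ {0ℝ +ᴿ w (suc i)} {w (suc i)} {sumᴿ w} (λ t → ℚₚ.+-identityˡ (seq (w (suc i)) t))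
      (+ᴿ-mono-≤ᴿ {0ℝ} {w zero} {w (suc i)} {sumᴿ (w ∘ suc)} (w≥0 zero)
        (term-≤ᴿ-sumᴿ {w = w ∘ suc} (w≥0 ∘ suc) i))

  squeeze : ∀ {x y} → 0ℝ ≤ᴿ x → x ≤ᴿ y → y ≃ 0ℝ → x ≃ 0ℝ
  squeeze {x} {y} 0≤x x≤y y≃0 ε 0<ε =
    let (N₁ , h₁) = 0≤x ε 0<ε
        (N₂ , h₂) = x≤y (half ε) (0<half 0<ε)
        (N₃ , h₃) = y≃0 (half ε) (0<half 0<ε)
    in N₁ ℕ.⊔ (N₂ ℕ.⊔ N₃) , λ n N≤n →
      let N₂₃≤n = ℕₚ.m⊔n≤o⇒n≤o N₁ (N₂ ℕ.⊔ N₃) N≤n in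
      ∣p∣≤q
        (begin
          seq x n ℚ.- 0ℚ            ≡⟨ ℚₚ.+-identityʳ (seq x n) ⟩
          seq x n                   ≤⟨ h₂ n (ℕₚ.m⊔n≤o⇒m≤o N₂ N₃ N₂₃≤n) ⟩
          seq y n ℚ.+ half ε        ≤⟨ ℚₚ.+-monoˡ-≤ (half ε) (∣p-q∣≤r⇒p≤q+r {seq y n} {0ℚ} (h₃ n (ℕₚ.m⊔n≤o⇒n≤o N₂ N₃ N₂₃≤n))) ⟩
          0ℚ ℚ.+ half ε ℚ.+ half ε  ≡⟨ cong (ℚ._+ half ε) (ℚₚ.+-identityˡ (half ε)) ⟩
          half ε ℚ.+ half ε         ≡⟨ half+half ε ⟩
          ε                         ∎)
        (≤-rearrange (h₁ n (ℕₚ.m⊔n≤o⇒m≤o N₁ (N₂ ℕ.⊔ N₃) N≤n))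
          (solve 2 (λ x e → :- (x :- con 0ℚ) :+ (x :+ e) := e :+ con 0ℚ) refl (seq x n) ε))
    where open ℚₚ.≤-Reasoning

  eventuallyBounded : ∀ x → ∃[ A ] (0ℚ ℚ.< A × ∃[ N ] (∀ n → N ℕ.≤ n → seq x n ℚ.≤ A))
  eventuallyBounded x =
    let (N , h) = cauchy x 1ℚ (ℚₚ.positive⁻¹ 1ℚ) in
    ℚ.∣ seq x N ∣ ℚ.+ 1ℚ , ℚₚ.+-mono-≤-< (ℚₚ.0≤∣p∣ (seq x N)) (ℚₚ.positive⁻¹ 1ℚ) ,
    N , λ n N≤n → ℚₚ.≤-trans (∣p-q∣≤r⇒p≤q+r (h n N N≤n ℕₚ.≤-refl))
      (ℚₚ.+-monoˡ-≤ 1ℚ (p≤∣p∣ (seq x N)))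

  divide : ∀ {ε C} → 0ℚ ℚ.< ε → 0ℚ ℚ.< C → ∃[ η ] (0ℚ ℚ.< η × C ℚ.* η ≡ ε)
  divide {ε} {C} 0<ε 0<C = ℚ.1/ C ℚ.* ε ,
    0<* (ℚₚ.positive⁻¹ (ℚ.1/ C) {{ℚₚ.1/pos⇒pos C}}) 0<ε ,
    trans (sym (ℚₚ.*-assoc C (ℚ.1/ C) ε))
      (trans (cong (ℚ._* ε) (ℚₚ.*-inverseʳ C)) (ℚₚ.*-identityˡ ε))
    where
    instance
      C-pos : ℚ.Positive C
      C-pos = ℚ.positive 0<C
      C-nonZero : ℚ.NonZero C
      C-nonZero = ℚₚ.pos⇒nonZero C

  -- Terms of a nonnegative real may dip to -η. If one factor is nonnegative, it is at most C and
  -- the other at least -η, so the product is at least -Cη; two nonpositive factors have a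
  -- nonnegative product.
  product-bound : ∀ {x y η C} → 0ℚ ℚ.≤ η → 0ℚ ℚ.≤ C → 0ℚ ℚ.≤ x ℚ.+ η → 0ℚ ℚ.≤ y ℚ.+ η →
    x ℚ.≤ C → y ℚ.≤ C → 0ℚ ℚ.≤ x ℚ.* y ℚ.+ C ℚ.* η
  product-bound {x} {y} {η} {C} 0≤η 0≤C x≥-η y≥-η x≤C y≤C
    with ℚₚ.≤-total 0ℚ x | ℚₚ.≤-total 0ℚ y
  ... | inj₁ 0≤x | _ = begin
    0ℚ                    ≤⟨ 0≤* 0≤x y≥-η ⟩
    x ℚ.* (y ℚ.+ η)       ≡⟨ ℚₚ.*-distribˡ-+ x y η ⟩
    x ℚ.* y ℚ.+ x ℚ.* η   ≤⟨ ℚₚ.+-monoʳ-≤ (x ℚ.* y) (ℚₚ.*-monoʳ-≤-nonNeg η {{ℚ.nonNegative 0≤η}} x≤C) ⟩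
    x ℚ.* y ℚ.+ C ℚ.* η   ∎
    where open ℚₚ.≤-Reasoning
  ... | inj₂ _ | inj₁ 0≤y = begin
    0ℚ                    ≤⟨ 0≤* x≥-η 0≤y ⟩
    (x ℚ.+ η) ℚ.* y       ≡⟨ solve 3 (λ x y e → (x :+ e) :* y := x :* y :+ y :* e) refl x y η ⟩
    x ℚ.* y ℚ.+ y ℚ.* η   ≤⟨ ℚₚ.+-monoʳ-≤ (x ℚ.* y) (ℚₚ.*-monoʳ-≤-nonNeg η {{ℚ.nonNegative 0≤η}} y≤C) ⟩
    x ℚ.* y ℚ.+ C ℚ.* η   ∎
    where open ℚₚ.≤-Reasoning
  ... | inj₂ x≤0 | inj₂ y≤0 = ℚₚ.+-mono-≤
    (ℚₚ.nonNegative⁻¹ (x ℚ.* y)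
      {{ℚₚ.nonPos*nonPos⇒nonPos x {{ℚ.nonPositive x≤0}} y {{ℚ.nonPositive y≤0}}}})
    (0≤* 0≤C 0≤η)

  *ᴿ-nonneg : ∀ {x y} → 0ℝ ≤ᴿ x → 0ℝ ≤ᴿ y → 0ℝ ≤ᴿ x *ᴿ y
  *ᴿ-nonneg {x} {y} 0≤x 0≤y ε 0<ε =
    let (A , 0<A , K₁ , b₁) = eventuallyBounded x
        (B , 0<B , K₂ , b₂) = eventuallyBounded y
        0<C = ℚₚ.+-mono-< 0<A 0<B
        (η , 0<η , Cη≡ε) = divide 0<ε 0<C
        (N₁ , h₁) = 0≤x η 0<η
        (N₂ , h₂) = 0≤y η 0<η
        A≤A+B = ≤-rearrange (ℚₚ.<⇒≤ 0<B) (solve 2 (λ a b → a :+ b := (a :+ b) :+ con 0ℚ) refl A B)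
        B≤A+B = ≤-rearrange (ℚₚ.<⇒≤ 0<A) (solve 2 (λ a b → b :+ a := (a :+ b) :+ con 0ℚ) refl A B)
    in (K₁ ℕ.⊔ K₂) ℕ.⊔ (N₁ ℕ.⊔ N₂) , λ n N≤n →
      let K≤n  = ℕₚ.m⊔n≤o⇒m≤o (K₁ ℕ.⊔ K₂) (N₁ ℕ.⊔ N₂) N≤n
          N≤n′ = ℕₚ.m⊔n≤o⇒n≤o (K₁ ℕ.⊔ K₂) (N₁ ℕ.⊔ N₂) N≤n
      in subst (λ e → 0ℚ ℚ.≤ seq x n ℚ.* seq y n ℚ.+ e) Cη≡ε
        (product-bound (ℚₚ.<⇒≤ 0<η) (ℚₚ.<⇒≤ 0<C)
          (h₁ n (ℕₚ.m⊔n≤o⇒m≤o N₁ N₂ N≤n′)) (h₂ n (ℕₚ.m⊔n≤o⇒n≤o N₁ N₂ N≤n′))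
          (ℚₚ.≤-trans (b₁ n (ℕₚ.m⊔n≤o⇒m≤o K₁ K₂ K≤n)) A≤A+B)
          (ℚₚ.≤-trans (b₂ n (ℕₚ.m⊔n≤o⇒n≤o K₁ K₂ K≤n)) B≤A+B))

  -- Constructively, the positive summand is found by inspecting one late term
  -- of the Cauchy sequence x.
  +ᴿ-positive : ∀ {x y} → 0ℝ <ᴿ x +ᴿ y → 0ℝ <ᴿ x ⊎ 0ℝ <ᴿ y
  +ᴿ-positive {x} {y} (ε , 0<ε , N , h) = split (ℚₚ.≤-total (δ ℚ.+ δ) (seq x T))
    where
    δ : ℚ
    δ = half (half ε)
    0<δ : 0ℚ ℚ.< δ
    0<δ = 0<half (0<half 0<ε)
    4δ≡ε : (δ ℚ.+ δ) ℚ.+ (δ ℚ.+ δ) ≡ ε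
    4δ≡ε = trans (cong₂ ℚ._+_ (half+half (half ε)) (half+half (half ε))) (half+half ε)
    N₁ T : ℕ
    N₁ = proj₁ (cauchy x δ 0<δ)
    T  = N ℕ.⊔ N₁
    close : ∀ m n → T ℕ.≤ m → T ℕ.≤ n → seq x m ℚ.≤ seq x n ℚ.+ δ
    close m n T≤m T≤n = ∣p-q∣≤r⇒p≤q+r
      (proj₂ (cauchy x δ 0<δ) m n (ℕₚ.m⊔n≤o⇒n≤o N N₁ T≤m) (ℕₚ.m⊔n≤o⇒n≤o N N₁ T≤n))
    -- From `T` on, x moves by at most δ = ε/4. If x is at least 2δ at `T`, it stays at least δ;
    -- otherwise it stays at most 3δ, which leaves at least δ of the sum 4δ to y.
    split : δ ℚ.+ δ ℚ.≤ seq x T ⊎ seq x T ℚ.≤ δ ℚ.+ δ → 0ℝ <ᴿ x ⊎ 0ℝ <ᴿ y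
    split (inj₁ large) = inj₁ (δ , 0<δ , T , λ n T≤n →
      ≤-rearrange (ℚₚ.≤-trans large (close T n ℕₚ.≤-refl T≤n))
        (solve 2 (λ d x → (con 0ℚ :+ d) :+ (x :+ d) := x :+ (d :+ d)) refl δ (seq x n)))
    split (inj₂ small) = inj₂ (δ , 0<δ , T , λ n T≤n →
      ≤-rearrange
        (ℚₚ.+-mono-≤
          (subst (λ e → 0ℚ ℚ.+ e ℚ.≤ seq x n ℚ.+ seq y n) (sym 4δ≡ε) (h n (ℕₚ.m⊔n≤o⇒m≤o N N₁ T≤n)))
          (ℚₚ.≤-trans (close n T T≤n ℕₚ.≤-refl) (ℚₚ.+-monoˡ-≤ δ small)))
        (solve 3 (λ d x y → (con 0ℚ :+ d) :+ ((x :+ y) :+ ((d :+ d) :+ d)) :=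
                            y :+ ((con 0ℚ :+ ((d :+ d) :+ (d :+ d))) :+ x)) refl δ (seq x n) (seq y n)))

  sumᴿ-positive : ∀ {n} {w : Fin n → ℝ} → 0ℝ <ᴿ sumᴿ w → ∃[ i ] 0ℝ <ᴿ w i
  sumᴿ-positive {zero} (ε , 0<ε , N , h) =
    contradiction (ℚₚ.<-≤-trans 0<ε (subst (ℚ._≤ 0ℚ) (ℚₚ.+-identityˡ ε) (h N ℕₚ.≤-refl))) (ℚₚ.<-irrefl refl)
  sumᴿ-positive {suc n} {w} pos with +ᴿ-positive {w zero} {sumᴿ (w ∘ suc)} pos
  ... | inj₁ head = zero , head
  ... | inj₂ tail = let (i , p) = sumᴿ-positive {w = w ∘ suc} tail in suc i , p

  ≃1⇒positive : ∀ {x} → x ≃ 1ℝ → 0ℝ <ᴿ x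
  ≃1⇒positive {x} x≃1 =
    let (N , h) = x≃1 ½ (ℚₚ.positive⁻¹ ½) in
    ½ , ℚₚ.positive⁻¹ ½ , N , λ n N≤n →
      ≤-rearrange (∣p-q∣≤r⇒p≤q+r {1ℚ} {seq x n} (subst (ℚ._≤ ½) (∣p-q∣≡∣q-p∣ (seq x n) 1ℚ) (h n N≤n)))
        (solve 1 (λ x → (con 0ℚ :+ con ½) :+ (x :+ con ½) := x :+ con 1ℚ) refl (seq x n))

  -- (a b) (c d) = (a d) (c b): two positive diagonal terms of a rank-one
  -- matrix exclude two vanishing off-diagonal ones.
  no-crossing : ∀ {a b c d} → 0ℝ <ᴿ a *ᴿ b → 0ℝ <ᴿ c *ᴿ d → a *ᴿ d ≃ 0ℝ → c *ᴿ b ≃ 0ℝ → ⊥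
  no-crossing {a} {b} {c} {d} (δ , 0<δ , N₁ , h₁) (ε , 0<ε , N₂ , h₂) ad≃0 cb≃0 =
    contradiction (ℚₚ.<-≤-trans halving impossible) (ℚₚ.<-irrefl refl)
    where
    open ℚₚ.≤-Reasoning
    N₃ N₄ n : ℕ
    -- The tolerances δ and ε/2 bound (ad)(cb) by δε/2, while (ab)(cd) is at least δε.
    N₃ = proj₁ (ad≃0 δ 0<δ)
    N₄ = proj₁ (cb≃0 (half ε) (0<half 0<ε))
    n  = (N₁ ℕ.⊔ N₂) ℕ.⊔ (N₃ ℕ.⊔ N₄)
    A B C D : ℚ
    A = seq a n
    B = seq b n
    C = seq c n
    D = seq d n
    12≤n : N₁ ℕ.⊔ N₂ ℕ.≤ n
    12≤n = ℕₚ.m≤m⊔n (N₁ ℕ.⊔ N₂) (N₃ ℕ.⊔ N₄)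
    34≤n : N₃ ℕ.⊔ N₄ ℕ.≤ n
    34≤n = ℕₚ.m≤n⊔m (N₁ ℕ.⊔ N₂) (N₃ ℕ.⊔ N₄)
    δ≤AB : δ ℚ.≤ A ℚ.* B
    δ≤AB = subst (ℚ._≤ A ℚ.* B) (ℚₚ.+-identityˡ δ) (h₁ n (ℕₚ.m⊔n≤o⇒m≤o N₁ N₂ 12≤n))
    ε≤CD : ε ℚ.≤ C ℚ.* D
    ε≤CD = subst (ℚ._≤ C ℚ.* D) (ℚₚ.+-identityˡ ε) (h₂ n (ℕₚ.m⊔n≤o⇒n≤o N₁ N₂ 12≤n))
    AD≤δ : ℚ.∣ A ℚ.* D ∣ ℚ.≤ δ
    AD≤δ = subst (λ x → ℚ.∣ x ∣ ℚ.≤ δ) (ℚₚ.+-identityʳ (A ℚ.* D))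
      (proj₂ (ad≃0 δ 0<δ) n (ℕₚ.m⊔n≤o⇒m≤o N₃ N₄ 34≤n))
    CB≤ε/2 : ℚ.∣ C ℚ.* B ∣ ℚ.≤ half ε
    CB≤ε/2 = subst (λ x → ℚ.∣ x ∣ ℚ.≤ half ε) (ℚₚ.+-identityʳ (C ℚ.* B))
      (proj₂ (cb≃0 (half ε) (0<half 0<ε)) n (ℕₚ.m⊔n≤o⇒n≤o N₃ N₄ 34≤n))
    halving : δ ℚ.* half ε ℚ.< δ ℚ.* ε
    halving = ℚₚ.*-monoʳ-<-pos δ {{ℚ.positive 0<δ}} (subst₂ ℚ._<_ (ℚₚ.+-identityʳ (half ε)) (half+half ε)
      (ℚₚ.+-monoʳ-< (half ε) (0<half 0<ε)))
    impossible : δ ℚ.* ε ℚ.≤ δ ℚ.* half ε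
    impossible = begin
      δ ℚ.* ε                               ≤⟨ *-mono-≤ (ℚₚ.<⇒≤ 0<ε) (ℚₚ.≤-trans (ℚₚ.<⇒≤ 0<δ) δ≤AB) δ≤AB ε≤CD ⟩
      (A ℚ.* B) ℚ.* (C ℚ.* D)               ≡⟨ solve 4 (λ a b c d → (a :* b) :* (c :* d) := (a :* d) :* (c :* b)) refl A B C D ⟩
      (A ℚ.* D) ℚ.* (C ℚ.* B)               ≤⟨ p≤∣p∣ _ ⟩
      ℚ.∣ (A ℚ.* D) ℚ.* (C ℚ.* B) ∣         ≡⟨ ℚₚ.∣p*q∣≡∣p∣*∣q∣ (A ℚ.* D) (C ℚ.* B) ⟩
      ℚ.∣ A ℚ.* D ∣ ℚ.* ℚ.∣ C ℚ.* B ∣       ≤⟨ *-mono-≤ (ℚₚ.0≤∣p∣ (C ℚ.* B)) (ℚₚ.<⇒≤ 0<δ) AD≤δ CB≤ε/2 ⟩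
      δ ℚ.* half ε                          ∎

-- Each diagonal entry has an inner index, its pivot, with a positive term. Off the diagonal all
-- terms vanish, being nonnegative with sum 0. By `no-crossing` no two rows share a pivot.
identity-rank₊ : ∀ {n s} (U : Matrix ℝ n s) (V : Matrix ℝ s n) → Nonnegative U → Nonnegative V →
  (∀ i → mulℝ U V i i ≃ 1ℝ) → (∀ i j → i ≢ j → mulℝ U V i j ≃ 0ℝ) → n ℕ.≤ s
identity-rank₊ {n} {s} U V U≥0 V≥0 diag off = Finₚ.injective⇒≤ {f = pivot} pivot-injective
  where
  abstract
    pivots : ∀ i → ∃[ q ] 0ℝ <ᴿ U i q *ᴿ V q i
    pivots i = sumᴿ-positive {w = λ q → U i q *ᴿ V q i} (≃1⇒positive {mulℝ U V i i} (diag i))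
  pivot : Fin n → Fin s
  pivot i = proj₁ (pivots i)
  term≥0 : ∀ i j q → 0ℝ ≤ᴿ U i q *ᴿ V q j
  term≥0 i j q = *ᴿ-nonneg {U i q} {V q j} (U≥0 i q) (V≥0 q j)
  vanish : ∀ i j q → i ≢ j → U i q *ᴿ V q j ≃ 0ℝ
  vanish i j q i≢j = squeeze {U i q *ᴿ V q j} {mulℝ U V i j} (term≥0 i j q)
    (term-≤ᴿ-sumᴿ {w = λ q → U i q *ᴿ V q j} (term≥0 i j) q) (off i j i≢j)
  same-pivot : ∀ {i j q} → 0ℝ <ᴿ U i q *ᴿ V q i → 0ℝ <ᴿ U j q *ᴿ V q j → i ≡ j
  same-pivot {i} {j} {q} pᵢ pⱼ with i Finₚ.≟ j
  ... | yes i≡j = i≡j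
  ... | no  i≢j = ⊥-elim (no-crossing {U i q} {V q i} {U j q} {V q j} pᵢ pⱼ
    (vanish i j q i≢j) (vanish j i q (i≢j ∘ sym)))
  pivot-injective : ∀ {i j} → pivot i ≡ pivot j → i ≡ j
  pivot-injective {i} {j} eq = same-pivot {i} {j} {pivot i} (proj₂ (pivots i))
    (subst (λ q → 0ℝ <ᴿ U j q *ᴿ V q j) (sym eq) (proj₂ (pivots j)))

-- Constant reals

ι : ℕ → ℚ
ι n = ℤ.+ n ℚ./ 1

ι-+ : ∀ m n → ι (m + n) ≡ ι m ℚ.+ ι n
ι-+ m n = ℚₚ.toℚᵘ-injective (begin
  ℚ.toℚᵘ (ι (m + n))                 ≈⟨ ℚₚ.toℚᵘ-fromℚᵘ (mkℚᵘ (ℤ.+ (m + n)) 0) ⟩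
  mkℚᵘ (ℤ.+ (m + n)) 0                 ≈⟨ *≡* (cong (ℤ._* ℤ.+ 1) (cong₂ ℤ._+_ (sym (ℤₚ.*-identityʳ (ℤ.+ m))) (sym (ℤₚ.*-identityʳ (ℤ.+ n))))) ⟩
  mkℚᵘ (ℤ.+ m) 0 ℚᵘ.+ mkℚᵘ (ℤ.+ n) 0     ≈⟨ ℚᵘₚ.+-cong (ℚₚ.toℚᵘ-fromℚᵘ (mkℚᵘ (ℤ.+ m) 0)) (ℚₚ.toℚᵘ-fromℚᵘ (mkℚᵘ (ℤ.+ n) 0)) ⟨
  ℚ.toℚᵘ (ι m) ℚᵘ.+ ℚ.toℚᵘ (ι n)     ≈⟨ ℚₚ.toℚᵘ-homo-+ (ι m) (ι n) ⟨
  ℚ.toℚᵘ (ι m ℚ.+ ι n)               ∎)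
  where open import Relation.Binary.Reasoning.Setoid ℚᵘₚ.≃-setoid

ι-* : ∀ m n → ι (m * n) ≡ ι m ℚ.* ι n
ι-* m n = ℚₚ.toℚᵘ-injective (begin
  ℚ.toℚᵘ (ι (m * n))                 ≈⟨ ℚₚ.toℚᵘ-fromℚᵘ (mkℚᵘ (ℤ.+ (m * n)) 0) ⟩
  mkℚᵘ (ℤ.+ (m * n)) 0                 ≈⟨ *≡* (cong (ℤ._* ℤ.+ 1) (ℤₚ.pos-* m n)) ⟩
  mkℚᵘ (ℤ.+ m) 0 ℚᵘ.* mkℚᵘ (ℤ.+ n) 0     ≈⟨ ℚᵘₚ.*-cong (ℚₚ.toℚᵘ-fromℚᵘ (mkℚᵘ (ℤ.+ m) 0)) (ℚₚ.toℚᵘ-fromℚᵘ (mkℚᵘ (ℤ.+ n) 0)) ⟨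
  ℚ.toℚᵘ (ι m) ℚᵘ.* ℚ.toℚᵘ (ι n)     ≈⟨ ℚₚ.toℚᵘ-homo-* (ι m) (ι n) ⟨
  ℚ.toℚᵘ (ι m ℚ.* ι n)               ∎)
  where open import Relation.Binary.Reasoning.Setoid ℚᵘₚ.≃-setoid

/-cancel-≤ : ∀ {a b c d} .{{_ : ℕ.NonZero b}} .{{_ : ℕ.NonZero d}} →
  ℤ.+ a ℚ./ b ℚ.≤ ℤ.+ c ℚ./ d → a * d ≤ c * b
/-cancel-≤ {a} {suc b} {c} {suc d} h
  with *≤* h′ ← ℚᵘₚ.≤-respʳ-≃ (ℚₚ.toℚᵘ-fromℚᵘ (mkℚᵘ (ℤ.+ c) d))
                 (ℚᵘₚ.≤-respˡ-≃ (ℚₚ.toℚᵘ-fromℚᵘ (mkℚᵘ (ℤ.+ a) b)) (ℚₚ.toℚᵘ-mono-≤ h)) =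
  ℤₚ.drop‿+≤+ (subst₂ ℤ._≤_ (sym (ℤₚ.pos-* a (suc d))) (sym (ℤₚ.pos-* c (suc b))) h′)

ι-mono-≤ : ∀ {m n} → m ≤ n → ι m ℚ.≤ ι n
ι-mono-≤ {m} {n} m≤n = ℚₚ.toℚᵘ-cancel-≤
  (ℚᵘₚ.≤-respʳ-≃ (ℚᵘₚ.≃-sym (ℚₚ.toℚᵘ-fromℚᵘ (mkℚᵘ (ℤ.+ n) 0)))
    (ℚᵘₚ.≤-respˡ-≃ (ℚᵘₚ.≃-sym (ℚₚ.toℚᵘ-fromℚᵘ (mkℚᵘ (ℤ.+ m) 0)))
      (*≤* (ℤₚ.*-monoʳ-≤-nonNeg (ℤ.+ 1) (ℤ.+≤+ m≤n)))))

0≤ι : ∀ n → 0ℚ ℚ.≤ ι n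
0≤ι n = ι-mono-≤ {0} {n} z≤n

-- Exact equality at every index, stronger than `_≃_`, so that computations with rational entries
-- stay in ℚ.
IsConstant : ℝ → ℚ → Set
IsConstant x q = ∀ t → seq x t ≡ q

constant-≃ : ∀ {x q} → IsConstant x q → x ≃ fromℚ q
constant-≃ {x} {q} x≡q ε 0<ε = 0 , λ n _ → ℚₚ.≤-trans
  (ℚₚ.≤-reflexive (cong ℚ.∣_∣ (trans (cong (ℚ._- q) (x≡q n)) (ℚₚ.+-inverseʳ q)))) (ℚₚ.<⇒≤ 0<ε)

constant-≤ᴿ : ∀ {x y p q} → IsConstant x p → IsConstant y q → p ℚ.≤ q → x ≤ᴿ y
constant-≤ᴿ {p = p} {q} x≡p y≡q p≤q ε 0<ε = 0 , λ n _ →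
  subst₂ (λ a b → a ℚ.≤ b ℚ.+ ε) (sym (x≡p n)) (sym (y≡q n))
    (subst (ℚ._≤ q ℚ.+ ε) (ℚₚ.+-identityʳ p) (ℚₚ.+-mono-≤ p≤q (ℚₚ.<⇒≤ 0<ε)))

-- If q < p, a rational m strictly between them and the tolerance m - q would give p ≤ m.
fromℚ-cancel-≤ : ∀ {p q} → fromℚ p ≤ᴿ fromℚ q → p ℚ.≤ q
fromℚ-cancel-≤ {p} {q} h with ℚₚ.≤-total p q
... | inj₁ p≤q = p≤q
... | inj₂ q≤p with q ℚₚ.<? p
...   | no  q≮p = ℚₚ.≮⇒≥ q≮p
...   | yes q<p =
  let (m , q<m , m<p) = ℚₚ.<-dense q<p
      (N , b) = h (m ℚ.- q) (subst (ℚ._< m ℚ.- q) (ℚₚ.+-inverseʳ q) (ℚₚ.+-monoˡ-< (ℚ.- q) q<m))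
  in contradiction (ℚₚ.<-≤-trans m<p (subst (p ℚ.≤_) (cancel q m) (b N ℕₚ.≤-refl))) (ℚₚ.<-irrefl refl)
  where
  open ℚ-Solver.+-*-Solver
  cancel : ∀ q m → q ℚ.+ (m ℚ.- q) ≡ m
  cancel = solve 2 (λ q m → q :+ (m :- q) := m) refl

fromℕ-^ᴿ : ∀ y q → IsConstant (fromℕ y ^ᴿ q) (ι (y ^ q))
fromℕ-^ᴿ y zero    t = refl
fromℕ-^ᴿ y (suc q) t = trans (cong (ι y ℚ.*_) (fromℕ-^ᴿ y q t)) (sym (ι-* y (y ^ q)))

-- Exponentiation

^-cancelˡ-≤ : ∀ {a b} q .{{_ : ℕ.NonZero q}} → a ^ q ≤ b ^ q → a ≤ b
^-cancelˡ-≤ q h = ℕₚ.≮⇒≥ λ b<a → ℕₚ.<⇒≱ (ℕₚ.^-monoˡ-< q b<a) h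

-- Raising to the power `Q` turns each comparison of `b ^ p` with `y ^ q` into one between powers of
-- `b` with exponents `p * Q` and `P * q`.
isPow : ∀ b P Q y .{{_ : ℕ.NonZero b}} .{{_ : ℕ.NonZero Q}} → b ^ P ≡ y ^ Q →
  IsPow b (fromℚ (ℤ.+ P ℚ./ Q)) (fromℕ y)
isPow b@(suc _) P Q y eq = constant-≤ᴿ {0ℝ} {fromℕ y} (λ _ → refl) (λ _ → refl) (0≤ι y) , λ p q →
  (λ h → constant-≤ᴿ {fromℕ (b ^ p)} {fromℕ y ^ᴿ q} (λ _ → refl) (fromℕ-^ᴿ y q)
    (ι-mono-≤ {b ^ p} {y ^ q} (below p q (/-cancel-≤ {p} {q} {P} {Q} (fromℚ-cancel-≤ h))))) ,
  (λ h → constant-≤ᴿ {fromℕ y ^ᴿ q} {fromℕ (b ^ p)} (fromℕ-^ᴿ y q) (λ _ → refl)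
    (ι-mono-≤ {y ^ q} {b ^ p} (above p q (/-cancel-≤ {P} {Q} {p} {q} (fromℚ-cancel-≤ h)))))
  where
  open ℕₚ.≤-Reasoning
  roots : ∀ q → b ^ (P * q) ≡ (y ^ q) ^ Q
  roots q = begin-equality
    b ^ (P * q)  ≡⟨ ℕₚ.^-*-assoc b P q ⟨
    (b ^ P) ^ q  ≡⟨ cong (_^ q) eq ⟩
    (y ^ Q) ^ q  ≡⟨ ℕₚ.^-*-assoc y Q q ⟩
    y ^ (Q * q)  ≡⟨ cong (y ^_) (ℕₚ.*-comm Q q) ⟩
    y ^ (q * Q)  ≡⟨ ℕₚ.^-*-assoc y q Q ⟨
    (y ^ q) ^ Q  ∎
  below : ∀ p q → p * Q ≤ P * q → b ^ p ≤ y ^ q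
  below p q pQ≤Pq = ^-cancelˡ-≤ Q (begin
    (b ^ p) ^ Q  ≡⟨ ℕₚ.^-*-assoc b p Q ⟩
    b ^ (p * Q)  ≤⟨ ℕₚ.^-monoʳ-≤ b pQ≤Pq ⟩
    b ^ (P * q)  ≡⟨ roots q ⟩
    (y ^ q) ^ Q  ∎)
  above : ∀ p q → P * q ≤ p * Q → y ^ q ≤ b ^ p
  above p q Pq≤pQ = ^-cancelˡ-≤ Q (begin
    (y ^ q) ^ Q  ≡⟨ roots q ⟨
    b ^ (P * q)  ≤⟨ ℕₚ.^-monoʳ-≤ b Pq≤pQ ⟩
    b ^ (p * Q)  ≡⟨ ℕₚ.^-*-assoc b p Q ⟨
    (b ^ p) ^ Q  ∎)

-- Nonnegative rank

sum-splitAt : ∀ m {n} (f : Fin m → ℕ) (g : Fin n → ℕ) →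
  sum (λ i → [ f , g ]′ (Fin.splitAt m i)) ≡ sum f + sum g
sum-splitAt zero    f g = refl
sum-splitAt (suc m) f g = trans
  (cong (λ x → f zero + x) (trans (sum-cong λ i → tail (Fin.splitAt m i)) (sum-splitAt m (f ∘ suc) g)))
  (sym (ℕₚ.+-assoc (f zero) (sum (f ∘ suc)) (sum g)))
  where
  tail : ∀ x → [ f , g ]′ (Sum.map₁ suc x) ≡ [ f ∘ suc , g ]′ x
  tail (inj₁ i) = refl
  tail (inj₂ j) = refl

-- The one-hot encoding: each position gets a block of ℓ coordinates, all 0 at a blank, so that
-- agreement counts become inner products.
indicator : ∀ {ℓ p} → Word ℓ p → Fin (p * ℓ) → ℕ
indicator {ℓ} (x ∷ w) = [ (λ y → bit (same x (suc y))) , indicator w ]′ ∘ Fin.splitAt ℓ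

same-sym : ∀ {ℓ} (x y : Fin (suc ℓ)) → same x y ≡ same y x
same-sym zero    zero    = refl
same-sym zero    (suc y) = refl
same-sym (suc x) zero    = refl
same-sym (suc x) (suc y) with x Finₚ.≟ y
... | yes refl = sym (dec-true (x Finₚ.≟ x) refl)
... | no  x≢y  = sym (dec-false (y Finₚ.≟ x) (x≢y ∘ sym))

sum-same : ∀ {ℓ} (x x′ : Fin (suc ℓ)) →
  sum {ℓ} (λ y → bit (same x (suc y)) * bit (same x′ (suc y))) ≡ bit (same x x′)
sum-same {ℓ} zero    x′ = sum-zero {ℓ} λ _ → refl
sum-same     (suc x) x′ = trans (sum-𝟙 x (λ y → bit (same x′ (suc y)))) (cong bit (same-sym x′ (suc x)))

sum-indicator : ∀ {ℓ p} (v w : Word ℓ p) → sum (λ q → indicator v q * indicator w q) ≡ agree v w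
sum-indicator         []      []      = refl
sum-indicator {ℓ} (x ∷ v) (y ∷ w) = trans
  (trans (sum-cong λ q → [,]-* (Fin.splitAt ℓ q)) (sum-splitAt ℓ _ _))
  (cong₂ _+_ (sum-same x y) (sum-indicator v w))
  where
  [,]-* : ∀ z → [ (λ y′ → bit (same x (suc y′))) , indicator v ]′ z *
                [ (λ y′ → bit (same y (suc y′))) , indicator w ]′ z ≡
    [ (λ y′ → bit (same x (suc y′)) * bit (same y (suc y′))) , (λ q → indicator v q * indicator w q) ]′ z
  [,]-* (inj₁ _) = refl
  [,]-* (inj₂ _) = refl

sumᴿ-constant : ∀ c {n} (f g : Fin n → ℕ) →
  IsConstant (sumᴿ (λ q → fromℚ (c ℚ.* ι (f q)) *ᴿ fromℕ (g q))) (c ℚ.* ι (sum (λ q → f q * g q)))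
sumᴿ-constant c {zero}  f g t = sym (ℚₚ.*-zeroʳ c)
sumᴿ-constant c {suc n} f g t = begin
  (c ℚ.* ι (f zero)) ℚ.* ι (g zero) ℚ.+ _
    ≡⟨ cong₂ ℚ._+_
         (trans (ℚₚ.*-assoc c _ _) (cong (c ℚ.*_) (sym (ι-* (f zero) (g zero)))))
         (sumᴿ-constant c (f ∘ suc) (g ∘ suc) t) ⟩
  c ℚ.* ι (f zero * g zero) ℚ.+ c ℚ.* ι (sum (λ q → f (suc q) * g (suc q)))
    ≡⟨ ℚₚ.*-distribˡ-+ c _ _ ⟨
  c ℚ.* (ι (f zero * g zero) ℚ.+ ι (sum (λ q → f (suc q) * g (suc q))))
    ≡⟨ cong (c ℚ.*_) (ι-+ (f zero * g zero) _) ⟨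
  c ℚ.* ι (sum (λ q → f q * g q)) ∎
  where open ≡-Reasoning

Factors₊ : PartialMatrix → ℕ → Set
Factors₊ M r = Σ (Matrix ℝ (rows M) r) λ U → Σ (Matrix ℝ r (cols M)) λ V →
  Nonnegative U × Nonnegative V × (∀ i j → Agreesℝ (entry M i j) (mulℝ U V i j))

agreesℝ-resp-≃ : ∀ e {x y} → x ≃ y → Agreesℝ e x → Agreesℝ e y
agreesℝ-resp-≃ 𝟎 {x} {y} x≃y x≃0 = ≃-trans {y} {x} {0ℝ} (≃-sym {x} {y} x≃y) x≃0
agreesℝ-resp-≃ 𝟏 {x} {y} x≃y x≃1 = ≃-trans {y} {x} {1ℝ} (≃-sym {x} {y} x≃y) x≃1
agreesℝ-resp-≃ ⋆ _ _ = _

isRank₊ : ∀ M {r} → IsMinimum (Factors₊ M) r → IsRank₊ M r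
isRank₊ M {r} ((U , V , U≥0 , V≥0 , agrees) , min) =
  (mulℝ U V ,
    (λ i j → sumᴿ-nonneg {w = λ q → U i q *ᴿ V q j}
      λ q → *ᴿ-nonneg {U i q} {V q j} (U≥0 i q) (V≥0 q j)) ,
    agrees , (U , V , U≥0 , V≥0 , λ i j → ≃-refl (mulℝ U V i j)) ,
    λ s (U′ , V′ , U′≥0 , V′≥0 , eq) → min s (U′ , V′ , U′≥0 , V′≥0 , λ i j →
      agreesℝ-resp-≃ (entry M i j) {mulℝ U V i j} {mulℝ U′ V′ i j} (eq i j) (agrees i j))) ,
  λ s (N , _ , N-agrees , (U′ , V′ , U′≥0 , V′≥0 , eq) , _) → min s (U′ , V′ , U′≥0 , V′≥0 , λ i j →
    agreesℝ-resp-≃ (entry M i j) {N i j} {mulℝ U′ V′ i j} (eq i j) (N-agrees i j))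
  where
  ≃-refl : ∀ x → x ≃ x
  ≃-refl x ε 0<ε = 0 , λ t _ → ℚₚ.≤-trans
    (ℚₚ.≤-reflexive (cong ℚ.∣_∣ (ℚₚ.+-inverseʳ (seq x t)))) (ℚₚ.<⇒≤ 0<ε)

module _ (ℓ p k : ℕ) .{{_ : ℕ.NonZero k}} where
  private
    M : PartialMatrix
    M = agreementMatrix ℓ p k

    n : ℕ
    n = p * ℓ

    abstract
      reciprocal : ∃[ c ] (0ℚ ℚ.< c × ι k ℚ.* c ≡ 1ℚ)
      reciprocal = divide (ℚₚ.positive⁻¹ 1ℚ)
        (ℚₚ.<-≤-trans (ℚₚ.positive⁻¹ 1ℚ) (ι-mono-≤ {1} {k} (ℕ.>-nonZero⁻¹ k)))

    -- Only row factors are scaled: by 1/k on words, where agreement k must become 1, and by 1 on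
    -- unit lines.
    weight : Fin n ⊎ Word ℓ p → ℚ
    weight = [ (λ _ → 1ℚ) , (λ _ → proj₁ reciprocal) ]′

    weight≥0 : ∀ v → 0ℚ ℚ.≤ weight v
    weight≥0 (inj₁ _) = ℚₚ.nonNegative⁻¹ 1ℚ
    weight≥0 (inj₂ _) = ℚₚ.<⇒≤ (proj₁ (proj₂ reciprocal))

    coeff : Fin n ⊎ Word ℓ p → Fin n → ℕ
    coeff = [ 𝟙 , indicator ]′

    product : Fin n ⊎ Word ℓ p → Fin n ⊎ Word ℓ p → ℚ
    product v w = weight v ℚ.* ι (sum (λ q → coeff v q * coeff w q))

    completion-agrees : ∀ v w {x} → IsConstant x (product v w) → Agreesℝ (blockEntry k v w) x
    completion-agrees (inj₁ i) (inj₁ j) {x} x≡ with i Finₚ.≟ j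
    ... | yes refl = constant-≃ {x} {1ℚ} λ t → trans (x≡ t)
      (trans (ℚₚ.*-identityˡ _)
        (cong ι (trans (sum-𝟙 i (𝟙 i)) (cong bit (dec-true (i Finₚ.≟ i) refl)))))
    ... | no i≢j = constant-≃ {x} {0ℚ} λ t → trans (x≡ t)
      (trans (ℚₚ.*-identityˡ _)
        (cong ι (trans (sum-𝟙 i (𝟙 j)) (cong bit (dec-false (j Finₚ.≟ i) (i≢j ∘ sym))))))
    completion-agrees (inj₁ i) (inj₂ w) _ = _
    completion-agrees (inj₂ v) (inj₁ j) _ = _
    completion-agrees (inj₂ v) (inj₂ w) {x} x≡
      with agree v w ℕₚ.≟ 0 | agree v w ℕₚ.≟ k
    ... | yes s≡0 | _ rewrite countEntry-0 k s≡0 = constant-≃ {x} {0ℚ} λ t →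
      trans (x≡ t) (trans (cong (λ s → proj₁ reciprocal ℚ.* ι s) (trans (sum-indicator v w) s≡0))
        (ℚₚ.*-zeroʳ (proj₁ reciprocal)))
    ... | no _ | yes s≡k rewrite countEntry-k {k} s≡k = constant-≃ {x} {1ℚ} λ t →
      trans (x≡ t) (trans (cong (λ s → proj₁ reciprocal ℚ.* ι s) (trans (sum-indicator v w) s≡k))
        (trans (ℚₚ.*-comm (proj₁ reciprocal) (ι k)) (proj₂ (proj₂ reciprocal))))
    ... | no s≢0 | no s≢k rewrite ≡ᵇ-false s≢0 | ≡ᵇ-false s≢k = _

  -- The unit lines cut out an identity matrix without wildcards.
  identity-bound : ∀ {s} → Factors₊ M s → n ≤ s
  identity-bound {s} (U , V , U≥0 , V≥0 , agrees) =
    identity-rank₊ (λ i q → U (unit i) q) (λ q j → V q (unit j))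
      (λ i q → U≥0 (unit i) q) (λ q j → V≥0 q (unit j))
      (λ i → value 𝟏 i i (cong (λ b → if b then 𝟏 else 𝟎) (dec-true (i Finₚ.≟ i) refl)))
      (λ i j i≢j → value 𝟎 i j (cong (λ b → if b then 𝟏 else 𝟎) (dec-false (i Finₚ.≟ j) i≢j)))
    where
    unit : Fin n → Fin (lines ℓ p)
    unit = unitLine {ℓ} {p}
    value : ∀ e i j → identityEntry i j ≡ e → Agreesℝ e (mulℝ U V (unit i) (unit j))
    value e i j eq = subst (λ e → Agreesℝ e (mulℝ U V (unit i) (unit j)))
      (trans (cong₂ (blockEntry k) (line-unitLine {ℓ} {p} i) (line-unitLine {ℓ} {p} j)) eq)
      (agrees (unit i) (unit j))

  -- Unit lines take standard basis vectors and words take their indicators, which meets the bound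
  -- `identity-bound` exactly.
  indicatorFactors : Factors₊ M n
  indicatorFactors = U , V , U≥0 , V≥0 , λ i j →
    completion-agrees (lineOf i) (lineOf j) {mulℝ U V i j}
      (sumᴿ-constant (weight (lineOf i)) (coeff (lineOf i)) (coeff (lineOf j)))
    where
    lineOf : Fin (lines ℓ p) → Fin n ⊎ Word ℓ p
    lineOf = line {ℓ} {p}
    U : Matrix ℝ (lines ℓ p) n
    U i q = fromℚ (weight (lineOf i) ℚ.* ι (coeff (lineOf i) q))
    V : Matrix ℝ n (lines ℓ p)
    V q j = fromℕ (coeff (lineOf j) q)
    U≥0 : Nonnegative U
    U≥0 i q = constant-≤ᴿ {0ℝ} {U i q} (λ _ → refl) (λ _ → refl)
      (0≤* (weight≥0 (lineOf i)) (0≤ι (coeff (lineOf i) q)))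
    V≥0 : Nonnegative V
    V≥0 q j = constant-≤ᴿ {0ℝ} {V q j} (λ _ → refl) (λ _ → refl) (0≤ι (coeff (lineOf j) q))

  agreementMatrix-rank₊ : IsRank₊ M n
  agreementMatrix-rank₊ = isRank₊ M (indicatorFactors , λ s → identity-bound)

-- The sequence of matrices and the exponent

n≤2^n : ∀ n → n ≤ 2 ^ n
n≤2^n zero    = z≤n
n≤2^n (suc n) = ℕₚ.+-mono-≤ (ℕₚ.m^n>0 2 n) (ℕₚ.≤-trans (n≤2^n n) (ℕₚ.m≤m+n (2 ^ n) 0))

-- The nonnegative rank is recorded as a perfect square, so that its power with exponent 1/2 is the
-- natural number `width`.
record Gap (t : ℕ) : Set where
  field
    matrix         : PartialMatrix
    width rank     : ℕ
    isRank₊-width² : IsRank₊ matrix (width * width)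
    isRank₀₁-rank  : IsRank₀₁ matrix rank
    2^width≤rank   : 2 ^ width ≤ rank
    t<width        : t < width

-- Alphabet size and word length are both w = 2k = 2^(4 + t); the offset 3 ensures w ≥ 16.
gap-from : ∀ t k′ → suc k′ ≡ 2 ^ (3 + t) → Gap t
gap-from t k′ k≡2^ = record
  { matrix         = M
  ; width          = w
  ; rank           = proj₁ minimal
  ; isRank₊-width² = agreementMatrix-rank₊ w w k
  ; isRank₀₁-rank  = isRank₀₁ M (proj₂ minimal)
  ; 2^width≤rank   = factors₀₁-exponential (subst Frobenius (sym k≡2^) (frobenius (3 + t)))
                       16≤w (proj₁ (proj₂ minimal))
  ; t<width        = ℕₚ.≤-trans (ℕₚ.m≤n+m (suc t) 3) (ℕₚ.≤-trans (n≤2^n (4 + t)) 2^≤w)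
  }
  where
  open ℕₚ.≤-Reasoning
  k w : ℕ
  k = suc k′
  w = suc (k + k′)
  M : PartialMatrix
  M = agreementMatrix w w k
  minimal : ∃[ r ] IsMinimum (Factors₀₁ M) r
  minimal = minimalFactors₀₁ M
  2^≤w : 2 ^ (4 + t) ≤ w
  2^≤w = begin
    2 * 2 ^ (3 + t) ≡⟨ cong (2 *_) k≡2^ ⟨
    2 * k           ≡⟨ cong (λ x → k + x) (ℕₚ.+-identityʳ k) ⟩
    k + k           ≡⟨ ℕₚ.+-suc k k′ ⟩
    w               ∎
  16≤w : 16 ≤ w
  16≤w = ℕₚ.≤-trans (ℕₚ.^-monoʳ-≤ 2 (ℕₚ.m≤m+n 4 t)) 2^≤w

abstract
  gap : ∀ t → Gap t
  gap t = gap-from t (ℕ.pred (2 ^ (3 + t))) (ℕₚ.suc-pred (2 ^ (3 + t)) {{ℕₚ.m^n≢0 2 (3 + t)}})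

theorem1 : Σ ℝ λ c → 0ℝ <ᴿ c ×
    Σ (ℕ → PartialMatrix) λ M →
    Σ (ℕ → ℕ) λ rank₊ →
    Σ (ℕ → ℕ) λ rank₀₁ →
    (∀ t → IsRank₊ (M t) (rank₊ t)) ×
    (∀ t → IsRank₀₁ (M t) (rank₀₁ t)) ×
    TendsToInfinity rank₊ ×
    (∀ t → ∃[ y ] ∃[ z ]
    (IsPow (rank₊ t) c y × IsPow 2 y z × z ≤ᴿ fromℕ (rank₀₁ t)))
theorem1 =
  -- The nonnegative rank is w² and the binary rank at least 2^w, so c = 1/2 works, with witnesses w
  -- for the inner power and 2^w for the outer one.
  fromℚ ½ ,
  (½ , ℚₚ.positive⁻¹ ½ , 0 , λ _ _ → ℚₚ.≤-refl) ,
  (λ t → matrix (gap t)) , (λ t → width (gap t) * width (gap t)) , (λ t → rank (gap t)) ,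
  (λ t → isRank₊-width² (gap t)) ,
  (λ t → isRank₀₁-rank (gap t)) ,
  (λ K → K , λ t K≤t → unbounded (gap t) K≤t) ,
  λ t → fromℕ (width (gap t)) , fromℕ (2 ^ width (gap t)) , bounds (gap t)
  where
  open Gap

  width-nonZero : ∀ {t} (g : Gap t) → ℕ.NonZero (width g)
  width-nonZero g = ℕ.>-nonZero (ℕₚ.≤-trans (s≤s z≤n) (t<width g))

  unbounded : ∀ {t K} (g : Gap t) → K ≤ t → K ≤ width g * width g
  unbounded g K≤t = ℕₚ.≤-trans (ℕₚ.≤-trans K≤t (ℕₚ.<⇒≤ (t<width g)))
    (ℕₚ.m≤m*n (width g) (width g) {{width-nonZero g}})

  square : ∀ y → (y * y) ^ 1 ≡ y ^ 2
  square y = trans (ℕₚ.*-identityʳ (y * y)) (cong (y *_) (sym (ℕₚ.*-identityʳ y)))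

  bounds : ∀ {t} (g : Gap t) →
    IsPow (width g * width g) (fromℚ ½) (fromℕ (width g)) ×
    IsPow 2 (fromℕ (width g)) (fromℕ (2 ^ width g)) ×
    fromℕ (2 ^ width g) ≤ᴿ fromℕ (rank g)
  bounds g =
    isPow (w * w) 1 2 w {{ℕₚ.m*n≢0 w w {{width-nonZero g}} {{width-nonZero g}}}} (square w) ,
    isPow 2 w 1 (2 ^ w) (sym (ℕₚ.^-identityʳ (2 ^ w))) ,
    constant-≤ᴿ {fromℕ (2 ^ w)} {fromℕ (rank g)} (λ _ → refl) (λ _ → refl)
      (ι-mono-≤ {2 ^ w} {rank g} (2^width≤rank g))
    where
    w : ℕ
    w = width g
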